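{- Let $G=(V,E)$ be a simple undirected graph with $V=\{v_1,\ldots,v_n\}$, let $K=\{v_1,\ldots,v_k\}$ with $k>1$, and assume that $K$ is an independent set, that each $v_i\in K$ has degree exactly $2$ with $N(v_i)=\{v_{k+2i-1},v_{k+2i}\}$ for $i\in[k]$, and that no two vertices of $K$ have a common neighbour. For each edge $v_iv_j\in E$ with $i<j$ let $x_{ij}$ be a distinct commuting indeterminate, and work over a field of characteristic two. Define the $n\times n$ matrix $M_G$ by: for $i\neq j$, $M_G(i,j)=x_{\min(i,j)\max(i,j)}$ if $v_iv_j\in E$ and $0$ otherwise; $M_G(i,i)=1$ for $i>3k$ and $M_G(i,i)=0$ for $i\le 3k$; and then set $M_G(1,k+2)=M_G(k+1,1)=0$. An orientation of $M_G$ is a matrix obtained from $M_G$ by choosing, independently for every $i\in\{2,\ldots,k\}$, one of the two options: either set $M_G(k+2i-1,i)=M_G(i,k+2i)=0$, or set $M_G(k+2i,i)=M_G(i,k+2i-1)=0$. Let $Q'$ be the sum of $\det M'_G$ over all $2^{k-1}$ orientations $M'_G$ of $M_G$. Then $G$ has a $K$-cycle if and only if $Q'$ is not identically zero (as a polynomial in the $x_{ij}$).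
   Context: A $K$-cycle in $G$ is a (simple) cycle in $G$ passing through every vertex of $K$ (possibly also through other vertices). $N(v)$ denotes the set of neighbours of $v$, and $[k]=\{1,\ldots,k\}$. -}

module Defs where

open import Level using (Level)
open import Data.Bool using (Bool; true; false; _∧_; _∨_; if_then_else_; not)
open import Data.Nat using (ℕ; zero; suc; _∸_; _≡ᵇ_; _<ᵇ_; _<_; _≤_)
open import Data.Fin using (Fin; toℕ; punchIn)
import Data.Fin as Fin
open import Data.Vec using (Vec; replicate; zipWith; updateAt)
import Data.Vec as Vec
open import Data.Vec.Properties using (≡-dec)
import Data.Nat as ℕ
open import Data.List using (List; []; _∷_; _++_; map; concatMap; length; foldr)
open import Data.List.Membership.Propositional using (_∈_)
open import Data.List.Relation.Unary.Unique.Propositional using (Unique)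
open import Data.List.Relation.Unary.Linked using (Linked)
open import Data.Product using (_×_; _,_; ∃; Σ)
open import Data.Sum using (_⊎_)
open import Relation.Nullary using (¬_; yes; no)
open import Relation.Binary.PropositionalEquality using (_≡_)
open import Algebra.Bundles using (CommutativeRing)

record IsFieldChar2 {c ℓ} (R : CommutativeRing c ℓ) : Set (c Level.⊔ ℓ) where
  open CommutativeRing R
  field
    nontrivial : ¬ (1# ≈ 0#)
    inverse    : ∀ x → ¬ (x ≈ 0#) → ∃ λ y → (x * y) ≈ 1#
    char2      : (1# + 1#) ≈ 0#

-- Simple graphs on the vertex set Fin n (vertex v_{i+1} is Fin index i)

record SimpleGraph (n : ℕ) : Set where
  field
    adj   : Fin n → Fin n → Bool
    sym   : ∀ i j → adj i j ≡ adj j i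
    irrefl : ∀ i → adj i i ≡ false

Adj : ∀ {n} → SimpleGraph n → Fin n → Fin n → Set
Adj G i j = SimpleGraph.adj G i j ≡ true

lastOf : ∀ {A : Set} → A → List A → A
lastOf x []       = x
lastOf x (y ∷ ys) = lastOf y ys

IsCycle : ∀ {n} → SimpleGraph n → List (Fin n) → Set
IsCycle G []       = Data.Empty.⊥ where import Data.Empty
IsCycle G (x ∷ xs) =
  (2 ≤ length xs) × Unique (x ∷ xs) × Linked (Adj G) (x ∷ xs) × Adj G (lastOf x xs) x

HasKCycle : ∀ {n} → SimpleGraph n → ℕ → Set
HasKCycle {n} G k =
  ∃ λ (cyc : List (Fin n)) → IsCycle G cyc × (∀ (v : Fin n) → toℕ v < k → v ∈ cyc)

-- Multivariate polynomials over a commutative ring R in the commuting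
-- indeterminates x_{ij} (i,j : Fin n).  A monomial is an exponent
-- vector; a polynomial is a formal (finite) sum of coefficient·monomial
-- terms.  Equality with zero is judged coefficientwise.

module Poly {c ℓ} (R : CommutativeRing c ℓ) (n : ℕ) where
  open CommutativeRing R renaming (Carrier to A)

  Monomial : Set
  Monomial = Vec (Vec ℕ n) n

  mon1 : Monomial
  mon1 = replicate n (replicate n 0)

  monMul : Monomial → Monomial → Monomial
  monMul = zipWith (zipWith ℕ._+_)

  monVar : Fin n → Fin n → Monomial
  monVar i j = updateAt mon1 i (λ row → updateAt row j (λ _ → 1))

  Polynomial : Set c
  Polynomial = List (A × Monomial)

  pzero : Polynomial
  pzero = []

  pone : Polynomial
  pone = (1# , mon1) ∷ []

  pvar : Fin n → Fin n → Polynomial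
  pvar i j = (1# , monVar i j) ∷ []

  _⊕_ : Polynomial → Polynomial → Polynomial
  _⊕_ = _++_

  ⊖_ : Polynomial → Polynomial
  ⊖ p = map (λ { (a , m) → (- a , m) }) p

  _⊗_ : Polynomial → Polynomial → Polynomial
  p ⊗ q = concatMap (λ { (a , m) → map (λ { (b , m′) → (a * b , monMul m m′) }) q }) p

  coeff : Monomial → Polynomial → A
  coeff m [] = 0#
  coeff m ((a , m′) ∷ p) with ≡-dec (≡-dec ℕ._≟_) m m′
  ... | yes _ = a + coeff m p
  ... | no  _ = coeff m p

  IsZeroPoly : Polynomial → Set ℓ
  IsZeroPoly p = ∀ (m : Monomial) → coeff m p ≈ 0#

  sumP : List Polynomial → Polynomial
  sumP = foldr _⊕_ pzero

  det : ∀ {m} → (Fin m → Fin m → Polynomial) → Polynomial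
  det {zero}  M = pone
  det {suc m} M = go′ (Vec.toList (Vec.allFin (suc m))) true
    where
      go′ : List (Fin (suc m)) → Bool → Polynomial
      go′ []       _ = pzero
      go′ (j ∷ js) s =
        (let t = M Fin.zero j ⊗ det (λ r c′ → M (Fin.suc r) (punchIn j c′))
         in if s then t else ⊖ t) ⊕ go′ js (not s)

allBoolLists : ℕ → List (List Bool)
allBoolLists zero    = [] ∷ []
allBoolLists (suc m) = map (true ∷_) (allBoolLists m) ++ map (false ∷_) (allBoolLists m)

lookupB : List Bool → ℕ → Bool
lookupB []       _       = false
lookupB (b ∷ bs) zero    = b
lookupB (b ∷ bs) (suc i) = lookupB bs i

-- An orientation is a list o of k-1 Booleans; entry o[p-1] is the choice
-- for the (0-based) vertex p ∈ {1,…,k-1}, i.e. for v_i with i = p+1 ∈ {2,…,k}.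
--   o[p-1] = false : set M(k+2i-1,i) = M(i,k+2i) = 0
--   o[p-1] = true  : set M(k+2i,i)   = M(i,k+2i-1) = 0
-- (all indices here 1-based; below everything is 0-based, so
--  v_{k+2i-1} has index k+2p and v_{k+2i} has index k+2p+1).
-- The fixed changes M(1,k+2) = M(k+1,1) = 0 are 0-based (0,k+1) and (k,0).
zeroed : ℕ → List Bool → ℕ → ℕ → Bool
zeroed k o a b =
     ((a ≡ᵇ 0) ∧ (b ≡ᵇ suc k))
  ∨ ((a ≡ᵇ k) ∧ (b ≡ᵇ 0))
  ∨ (((0 <ᵇ b) ∧ (b <ᵇ k)) ∧
       (a ≡ᵇ (if lookupB o (b ∸ 1) then k ℕ.+ 2 ℕ.* b ℕ.+ 1 else k ℕ.+ 2 ℕ.* b)))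
  ∨ (((0 <ᵇ a) ∧ (a <ᵇ k)) ∧
       (b ≡ᵇ (if lookupB o (a ∸ 1) then k ℕ.+ 2 ℕ.* a else k ℕ.+ 2 ℕ.* a ℕ.+ 1)))

module MG {c ℓ} (R : CommutativeRing c ℓ) {n : ℕ} (G : SimpleGraph n) (k : ℕ) where
  open Poly R n

  xvar : Fin n → Fin n → Polynomial
  xvar a b = if toℕ a <ᵇ toℕ b then pvar a b else pvar b a

  -- M_G before the modifications M(1,k+2) = M(k+1,1) = 0
  M₀ : Fin n → Fin n → Polynomial
  M₀ a b with toℕ a ℕ.≟ toℕ b
  ... | yes _ = if toℕ a <ᵇ 3 ℕ.* k then pzero else pone
  ... | no  _ = if SimpleGraph.adj G a b then xvar a b else pzero

  Mo : List Bool → Fin n → Fin n → Polynomial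
  Mo o a b = if zeroed k o (toℕ a) (toℕ b) then pzero else M₀ a b

  Q′ : Polynomial
  Q′ = sumP (map (λ o → det (Mo o)) (allBoolLists (k ∸ 1)))

module Submission where

open import Defs
open import Data.Nat using (ℕ; _<_; _≤_; _+_; _*_)
open import Data.Fin using (Fin; toℕ)
open import Data.Sum using (_⊎_)
open import Relation.Nullary using (¬_)
open import Relation.Binary.PropositionalEquality using (_≡_; _≢_)
open import Function.Bundles using (_⇔_)
open import Algebra.Bundles using (CommutativeRing)

open import Level using (0ℓ)
open import Data.Bool as Bool using (Bool; true; false; not; if_then_else_; T; _∧_; _∨_; _xor_)
import Data.Bool.Properties as Boolₚ
open import Data.Nat as ℕ using (zero; suc; _∸_; _≡ᵇ_; _<ᵇ_; s≤s; z≤n)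
import Data.Nat.Properties as ℕₚ
open import Data.Nat.Divisibility using (_∣_; divides; _∣0; ∣m∣n⇒∣m+n; ∣-refl)
open import Data.Nat.GeneralisedArithmetic using (fold; fold-+)
open import Data.Nat.Induction using (<-rec)
open import Data.Fin as Fin using (zero; suc; fromℕ<; punchIn; punchOut)
import Data.Fin.Properties as Finₚ
open import Data.Fin.Permutation using (Permutation′; permutation; _⟨$⟩ʳ_)
open import Data.Vec as Vec using (Vec; []; _∷_; lookup; tabulate)
import Data.Vec.Properties as Vecₚ
open import Data.List as List using (List; []; _∷_; _++_; length; map; filter; mapMaybe; fromMaybe; applyUpTo; cartesianProductWith; cartesianProduct)
import Data.List.Properties as Listₚ
open import Data.List.Membership.Propositional using (_∈_; _∉_; find; lose)
import Data.List.Membership.DecPropositional as DecMembership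
import Data.List.Membership.Propositional.Properties as ∈ₚ
open import Data.List.Relation.Unary.Any as Any using (here; there)
open import Data.List.Relation.Unary.All as All using ([]; _∷_)
open import Data.List.Relation.Unary.AllPairs as AllPairs using ([]; _∷_)
open import Data.List.Relation.Unary.Linked using (Linked; _∷_)
import Data.List.Relation.Unary.Linked.Properties as Linkedₚ
open import Data.List.Relation.Unary.Unique.Propositional using (Unique)
import Data.List.Relation.Unary.Unique.Propositional.Properties as Uniqueₚ
open import Data.List.Relation.Binary.Permutation.Propositional using (_↭_; prep; ↭-sym; ↭⇒↭ₛ)
import Data.List.Relation.Binary.Permutation.Propositional.Properties as ↭ₚ
import Data.List.Relation.Binary.Permutation.Setoid.Properties as ↭ₛₚ
open import Data.List.Relation.Binary.Pointwise as Pointwise using (Pointwise; []; _∷_)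
open import Data.Maybe as Maybe using (Maybe; just; nothing)
import Data.Maybe.Properties as Maybeₚ
open import Data.Product using (_×_; _,_; proj₁; proj₂; ∃)
import Data.Product.Properties as ×ₚ
open import Data.Sum using (inj₁; inj₂; [_,_]′; map₂)
open import Data.Empty using (⊥; ⊥-elim)
open import Function using (_∘_; id; case_of_; mk⇔; Equivalence)
open import Function.Definitions using (Injective)
open import Relation.Nullary using (Dec; yes; no; does; ¬?; _×-dec_)
open import Relation.Nullary.Decidable using (does-⇔)
open import Relation.Unary using (Decidable)
open import Relation.Binary.Definitions using (tri<; tri≈; tri>)
open import Relation.Binary.PropositionalEquality
  using (refl; sym; trans; cong; cong₂; subst; subst₂; setoid; isEquivalence)
open import Algebra.Bundles using (CommutativeMonoid)
import Algebra.Properties.CommutativeMonoid.Sum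
import Algebra.Properties.Monoid.Mult
import Algebra.Properties.Ring
open Algebra.Properties.CommutativeMonoid.Sum ℕₚ.+-0-commutativeMonoid using () renaming (sum to ∑)

-- A choice of an orientation o and a permutation σ contributes the monomial ∏ᵢ Mₒ(i, σ i), and in
-- characteristic two a coefficient of Q′ is the parity of the number of pairs (o, σ) contributing
-- that monomial.  Let O be the σ-orbit of v₁.  Inverting σ outside O, and swapping the orientation
-- at the vertices of K outside O, is an involution on pairs which keeps the monomial, since M is
-- symmetric off the row and column of v₁.  It fixes a pair only if K ⊆ O, and then O is a K-cycle;
-- so without a K-cycle all counts are even.  Conversely, direct a K-cycle so that it leaves v₁
-- through v_{k+1}, and fix all vertices off the cycle.  The resulting monomial is the squarefree
-- product of the edges of the cycle, and no other pair contributes it: starting at v₁, each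
-- further arc is forced.

-- The sum over orientations is what makes the reversal available. A single orientation destroys the
-- symmetry of the matrix at the vertices of K: each of them may be entered only from one neighbour
-- and left only towards the other. Reversing arcs there gives a forbidden direction, and exactly
-- the swapped choice permits it again. The swap also explains the fixed pairs: a vertex of K
-- outside O has its choice changed, so the pair changes even if σ is its own inverse off O. At v₁
-- there is no choice to swap; its two fixed zeros break the symmetry for good, which is why O is
-- left untouched. They also keep O from collapsing to an edge run back and forth: σ must send v₁ to
-- v_{k+1}, and from there it cannot return at once. The uniqueness argument has the same obstacle,
-- since a monomial records edges without direction. Directions are recovered from the forced first
-- arc and from the fact that a cycle uses no edge twice.

-- Parity from involutions without fixed points.

module _ {a} {A : Set a} (φ : A → A) where

  PairsUp : List A → Set a
  PairsUp xs = ∀ {x} → x ∈ xs → φ x ∈ xs × φ (φ x) ≡ x × φ x ≢ x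

  PairsUp-resp-↭ : ∀ {xs ys} → xs ↭ ys → PairsUp xs → PairsUp ys
  PairsUp-resp-↭ xs↭ys pairs y∈ =
    let φ∈ , rest = pairs (↭ₚ.∈-resp-↭ (↭-sym xs↭ys) y∈)
    in ↭ₚ.∈-resp-↭ xs↭ys φ∈ , rest

  PairsUp-drop₂ : ∀ {x zs} → Unique (x ∷ φ x ∷ zs) → PairsUp (x ∷ φ x ∷ zs) → PairsUp zs
  PairsUp-drop₂ {x} ((_ ∷ x∉) ∷ φx∉ ∷ _) pairs {z} z∈ with pairs (there (there z∈))
  ... | here φz≡x , φφz≡z , _ = ⊥-elim (All.lookup φx∉ z∈ (trans (cong φ (sym φz≡x)) φφz≡z))
  ... | there (here φz≡φx) , φφz≡z , _ =
    ⊥-elim (All.lookup x∉ z∈ (trans (sym (proj₁ (proj₂ (pairs (here refl))))) (trans (cong φ (sym φz≡φx)) φφz≡z)))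
  ... | there (there φz∈) , rest = φz∈ , rest

  fixpointFreeInvolution⇒evenLength : ∀ xs → Unique xs → PairsUp xs → 2 ∣ length xs
  fixpointFreeInvolution⇒evenLength xs = go (length xs) xs ℕₚ.≤-refl
    where
    -- Deleting `x` and `φ x` leaves `as ++ bs`, which is not a structural part of the list, so the
    -- recursion runs on a bound for the length.
    go : ∀ fuel xs → length xs ≤ fuel → Unique xs → PairsUp xs → 2 ∣ length xs
    go _ [] _ _ _ = 2 ∣0
    go (suc fuel) (x ∷ ys) (s≤s len) uniq pairs with pairs (here refl)
    ... | here φx≡x , _ , φx≢x = ⊥-elim (φx≢x φx≡x)
    ... | there φx∈ , _ with ∈ₚ.∈-∃++ φx∈
    ...   | as , bs , refl =
      subst (2 ∣_) (sym (↭ₚ.↭-length eq))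
        (∣m∣n⇒∣m+n ∣-refl (go fuel (as ++ bs) zs≤ (AllPairs.tail (AllPairs.tail uniq′)) (PairsUp-drop₂ uniq′ pairs′)))
      where
      eq : x ∷ as ++ φ x ∷ bs ↭ x ∷ φ x ∷ as ++ bs
      eq = prep x (↭ₚ.shift (φ x) as bs)
      uniq′ = ↭ₛₚ.Unique-resp-↭ (setoid A) (↭⇒↭ₛ eq) uniq
      pairs′ = PairsUp-resp-↭ eq pairs
      zs≤ : length (as ++ bs) ≤ fuel
      zs≤ = ℕₚ.≤-trans (ℕₚ.n≤1+n _) (ℕₚ.≤-trans (ℕₚ.≤-reflexive (sym (ℕₚ.suc-injective (↭ₚ.↭-length eq)))) len)

unique-singleton : ∀ {a} {A : Set a} {x : A} {xs} → Unique xs → x ∈ xs → (∀ {y} → y ∈ xs → y ≡ x) → length xs ≡ 1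
unique-singleton {xs = _ ∷ []} _ _ _ = refl
unique-singleton {xs = _ ∷ _ ∷ _} ((y≢z ∷ _) ∷ _) _ all≡ =
  ⊥-elim (y≢z (trans (all≡ (here refl)) (sym (all≡ (there (here refl))))))

-- Enumeration of permutations and orientations.

insertHead : ∀ {m} → Fin (suc m) → Vec (Fin m) m → Vec (Fin (suc m)) (suc m)
insertHead j τ = j ∷ Vec.map (punchIn j) τ

-- The order of enumeration is that of the terms in the Laplace expansion along the first row.
perms : ∀ m → List (Vec (Fin m) m)
perms zero    = [] ∷ []
perms (suc m) = cartesianProductWith insertHead (Vec.toList (Vec.allFin (suc m))) (perms m)

InjectiveVec : ∀ {m} → Vec (Fin m) m → Set
InjectiveVec σ = Injective _≡_ _≡_ (lookup σ)

map-injective : ∀ {a b} {A : Set a} {B : Set b} {f : A → B} → Injective _≡_ _≡_ f →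
                ∀ {n} {xs ys : Vec A n} → Vec.map f xs ≡ Vec.map f ys → xs ≡ ys
map-injective inj {xs = []} {[]} _ = refl
map-injective inj {xs = _ ∷ _} {_ ∷ _} eq = cong₂ _∷_ (inj (Vecₚ.∷-injectiveˡ eq)) (map-injective inj (Vecₚ.∷-injectiveʳ eq))

toList-tabulate : ∀ {a} {A : Set a} {n} (f : Fin n → A) → Vec.toList (tabulate f) ≡ List.tabulate f
toList-tabulate {n = zero} f = refl
toList-tabulate {n = suc n} f = cong (f zero ∷_) (toList-tabulate (f ∘ suc))

perms-unique : ∀ m → Unique (perms m)
perms-unique zero = [] ∷ []
perms-unique (suc m) =
  Uniqueₚ.cartesianProductWith⁺ insertHead
    (λ eq → head≡ eq , tail≡ eq) (subst Unique (sym (toList-tabulate id)) (Uniqueₚ.allFin⁺ (suc m))) (perms-unique m)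
  where
  head≡ : ∀ {i j : Fin (suc m)} {σ τ} → insertHead i σ ≡ insertHead j τ → i ≡ j
  head≡ = Vecₚ.∷-injectiveˡ
  tail≡ : ∀ {i j : Fin (suc m)} {σ τ} → insertHead i σ ≡ insertHead j τ → σ ≡ τ
  tail≡ {i} eq with refl ← Vecₚ.∷-injectiveˡ eq =
    map-injective (λ {x} {y} → Finₚ.punchIn-injective i x y) (Vecₚ.∷-injectiveʳ eq)

perms-injective : ∀ {m σ} → σ ∈ perms m → InjectiveVec σ
perms-injective {zero} _ {()}
perms-injective {suc m} σ∈ with ∈ₚ.∈-cartesianProductWith⁻ insertHead (Vec.toList (Vec.allFin (suc m))) (perms m) σ∈
... | j , τ , _ , τ∈ , refl = inj
  where
  inj : InjectiveVec (insertHead j τ)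
  inj {zero} {zero} _ = refl
  inj {zero} {suc y} eq = ⊥-elim (Finₚ.punchInᵢ≢i j (lookup τ y) (sym (trans eq (Vecₚ.lookup-map y (punchIn j) τ))))
  inj {suc x} {zero} eq = ⊥-elim (Finₚ.punchInᵢ≢i j (lookup τ x) (trans (sym (Vecₚ.lookup-map x (punchIn j) τ)) eq))
  inj {suc x} {suc y} eq = cong suc (perms-injective τ∈ (Finₚ.punchIn-injective j _ _
    (trans (sym (Vecₚ.lookup-map x (punchIn j) τ)) (trans eq (Vecₚ.lookup-map y (punchIn j) τ)))))

lookup-ext : ∀ {a} {A : Set a} {n} {xs ys : Vec A n} → (∀ i → lookup xs i ≡ lookup ys i) → xs ≡ ys
lookup-ext {xs = xs} {ys} eq = trans (sym (Vecₚ.tabulate∘lookup xs)) (trans (Vecₚ.tabulate-cong eq) (Vecₚ.tabulate∘lookup ys))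

perms-complete : ∀ {m} (σ : Vec (Fin m) m) → InjectiveVec σ → σ ∈ perms m
perms-complete [] _ = here refl
perms-complete {suc m} (j ∷ σ) inj =
  subst (_∈ perms (suc m)) (cong (j ∷_) (lookup-ext λ i →
    trans (Vecₚ.lookup-map i (punchIn j) τ) (trans (cong (punchIn j) (Vecₚ.lookup∘tabulate _ i)) (Finₚ.punchIn-punchOut (j≢ i)))))
    (∈ₚ.∈-cartesianProductWith⁺ insertHead j∈ (perms-complete τ τ-inj))
  where
  j≢ : ∀ i → j ≢ lookup σ i
  j≢ i eq with () ← inj {zero} {suc i} eq
  τ : Vec (Fin m) m
  τ = tabulate (λ i → punchOut (j≢ i))
  τ-inj : InjectiveVec τ
  τ-inj {x} {y} eq = Finₚ.suc-injective (inj (Finₚ.punchOut-injective (j≢ x) (j≢ y)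
    (trans (sym (Vecₚ.lookup∘tabulate _ x)) (trans eq (Vecₚ.lookup∘tabulate _ y)))))
  j∈ : j ∈ Vec.toList (Vec.allFin (suc m))
  j∈ = subst (j ∈_) (sym (toList-tabulate id)) (∈ₚ.∈-allFin j)

allBoolLists-unique : ∀ m → Unique (allBoolLists m)
allBoolLists-unique zero = [] ∷ []
allBoolLists-unique (suc m) = Uniqueₚ.++⁺
  (Uniqueₚ.map⁺ (λ { refl → refl }) (allBoolLists-unique m))
  (Uniqueₚ.map⁺ (λ { refl → refl }) (allBoolLists-unique m))
  (λ (p , q) → disjoint p q)
  where
  disjoint : ∀ {o} → o ∈ List.map (true ∷_) (allBoolLists m) → ¬ (o ∈ List.map (false ∷_) (allBoolLists m))
  disjoint p q with ∈ₚ.∈-map⁻ _ p | ∈ₚ.∈-map⁻ _ q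
  ... | _ , _ , refl | _ , _ , ()

allBoolLists-length : ∀ m {o} → o ∈ allBoolLists m → length o ≡ m
allBoolLists-length zero (here refl) = refl
allBoolLists-length (suc m) o∈ with ∈ₚ.∈-++⁻ (List.map (true ∷_) (allBoolLists m)) o∈
... | inj₁ p with _ , q , refl ← ∈ₚ.∈-map⁻ _ p = cong suc (allBoolLists-length m q)
... | inj₂ p with _ , q , refl ← ∈ₚ.∈-map⁻ _ p = cong suc (allBoolLists-length m q)

allBoolLists-complete : ∀ o → o ∈ allBoolLists (length o)
allBoolLists-complete [] = here refl
allBoolLists-complete (true ∷ o) = ∈ₚ.∈-++⁺ˡ (∈ₚ.∈-map⁺ _ (allBoolLists-complete o))
allBoolLists-complete (false ∷ o) = ∈ₚ.∈-++⁺ʳ _ (∈ₚ.∈-map⁺ _ (allBoolLists-complete o))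

-- Polynomials as lists of monomials, and the expansion of the determinant.

module TermExpansion {c ℓ} (R : CommutativeRing c ℓ) (n : ℕ) where
  open CommutativeRing R using (1#; 0#; -_; *-cong; *-identityˡ; +-cong; +-identityˡ)
    renaming (Carrier to A; _≈_ to infix 4 _≈_; _+_ to infixl 6 _+ᴿ_; _*_ to infixl 7 _*ᴿ_; refl to ≈-refl; sym to ≈-sym; trans to ≈-trans)
  open Poly R n

  -- nothing stands for the zero polynomial, just μ for the monomial μ with coefficient 1.
  infixl 7 _·_
  _·_ : Maybe Monomial → Maybe Monomial → Maybe Monomial
  _·_ = Maybe.zipWith monMul

  monMul-identityˡ : ∀ m → monMul mon1 m ≡ m
  monMul-identityˡ = Vecₚ.zipWith-identityˡ (Vecₚ.zipWith-identityˡ ℕₚ.+-identityˡ)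

  ·-comm : ∀ a b → a · b ≡ b · a
  ·-comm (just a) (just b) = cong just (Vecₚ.zipWith-comm (Vecₚ.zipWith-comm ℕₚ.+-comm) a b)
  ·-comm (just a) nothing = refl
  ·-comm nothing (just b) = refl
  ·-comm nothing nothing = refl

  ·-assoc : ∀ a b c → (a · b) · c ≡ a · (b · c)
  ·-assoc (just a) (just b) (just c) = cong just (Vecₚ.zipWith-assoc (Vecₚ.zipWith-assoc ℕₚ.+-assoc) a b c)
  ·-assoc (just a) (just b) nothing = refl
  ·-assoc (just a) nothing _ = refl
  ·-assoc nothing _ _ = refl

  ·-identityˡ : ∀ a → just mon1 · a ≡ a
  ·-identityˡ (just a) = cong just (monMul-identityˡ a)
  ·-identityˡ nothing = refl

  termMonoid : CommutativeMonoid 0ℓ 0ℓ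
  termMonoid = record
    { isCommutativeMonoid = record
      { isMonoid = record
        { isSemigroup = record
          { isMagma = record { isEquivalence = isEquivalence ; ∙-cong = cong₂ _·_ }
          ; assoc = ·-assoc }
        ; identity = ·-identityˡ , λ a → trans (·-comm a (just mon1)) (·-identityˡ a) }
      ; comm = ·-comm } }

  open Algebra.Properties.CommutativeMonoid.Sum termMonoid public
    using () renaming (sum to ∏; sum-cong-≗ to ∏-cong; sum-permute to ∏-permute)

  Term : A × Monomial → Monomial → Set ℓ
  Term (a , μ) ν = a ≈ 1# × μ ≡ ν

  infix 4 _≋_
  -- A `Polynomial` is an unnormalised list of terms. Matching it position by position with bare
  -- monomials postpones all collecting of like terms to `coeff-≋`, where it becomes counting.
  _≋_ : Polynomial → List Monomial → Set _
  _≋_ = Pointwise Term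

  ≋-scale : ∀ {a μ q ms} → a ≈ 1# → q ≋ ms →
            map (λ { (b , μ′) → (a *ᴿ b , monMul μ μ′) }) q ≋ map (monMul μ) ms
  ≋-scale a≈1 [] = []
  ≋-scale a≈1 ((b≈1 , refl) ∷ rest) = (≈-trans (*-cong a≈1 b≈1) (*-identityˡ 1#) , refl) ∷ ≋-scale a≈1 rest

  map-monMul-mapMaybe : ∀ {b} {B : Set b} μ (f : B → Maybe Monomial) xs →
                        map (monMul μ) (mapMaybe f xs) ≡ mapMaybe (λ x → just μ · f x) xs
  map-monMul-mapMaybe μ f xs = trans (Listₚ.map-mapMaybe (monMul μ) f xs)
    (Listₚ.mapMaybe-cong (λ x → lemma (f x)) xs)
    where
    lemma : ∀ e → Maybe.map (monMul μ) e ≡ just μ · e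
    lemma (just _) = refl
    lemma nothing = refl

  ⊗-≋ : ∀ {b} {B : Set b} {p q e} {f : B → Maybe Monomial} {xs} →
        p ≋ fromMaybe e → q ≋ mapMaybe f xs → p ⊗ q ≋ mapMaybe (λ x → e · f x) xs
  ⊗-≋ {e = nothing} {xs = xs} [] q≋ = subst ([] ≋_) (sym (Listₚ.mapMaybe-nothing xs)) []
  ⊗-≋ {e = just μ} {f} {xs} ((a≈1 , refl) ∷ []) q≋ =
    subst₂ _≋_ (sym (Listₚ.++-identityʳ _)) (map-monMul-mapMaybe μ f xs) (≋-scale a≈1 q≋)

  sumP-≋ : ∀ {b d} {B : Set b} {D : Set d} (P : B → Polynomial) (w : B → D → Maybe Monomial) {ds} →
           (∀ x → P x ≋ mapMaybe (w x) ds) → ∀ xs →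
           sumP (map P xs) ≋ mapMaybe (λ (x , y) → w x y) (cartesianProduct xs ds)
  sumP-≋ P w P≋ [] = []
  sumP-≋ P w {ds} P≋ (x ∷ xs) = subst (P x ⊕ sumP (map P xs) ≋_)
    (sym (trans (Listₚ.mapMaybe-++ _ (map (x ,_) ds) _) (cong (_++ _) (Listₚ.mapMaybe-map _ _ ds))))
    (Pointwise.++⁺ (P≋ x) (sumP-≋ P w P≋ xs))

  _≟ᵀ_ : (a b : Maybe Monomial) → Dec (a ≡ b)
  _≟ᵀ_ = Maybeₚ.≡-dec (Vecₚ.≡-dec (Vecₚ.≡-dec ℕ._≟_))

  open Algebra.Properties.Monoid.Mult (CommutativeRing.+-monoid R) using () renaming (_×_ to _⊠_)

  coeff-≋ : ∀ {b} {B : Set b} m (w : B → Maybe Monomial) xs {p} → p ≋ mapMaybe w xs →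
            coeff m p ≈ length (filter (λ x → w x ≟ᵀ just m) xs) ⊠ 1#
  coeff-≋ m w [] [] = ≈-refl
  coeff-≋ m w (x ∷ xs) p≋ with w x
  ... | nothing = coeff-≋ m w xs p≋
  -- `coeff` decides `m ≡ μ` whereas the filter decides `μ ≡ m`; both tests are split and the mixed
  -- outcomes contradict each other.
  coeff-≋ m w (x ∷ xs) {(_ , μ) ∷ p} ((a≈1 , refl) ∷ p≋) | just .μ
    with Vecₚ.≡-dec (Vecₚ.≡-dec ℕ._≟_) m μ | Vecₚ.≡-dec (Vecₚ.≡-dec ℕ._≟_) μ m
  ... | yes _ | yes _ = +-cong a≈1 (coeff-≋ m w xs p≋)
  ... | no _  | no _  = coeff-≋ m w xs p≋
  ... | yes refl | no ≢ = ⊥-elim (≢ refl)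
  ... | no ≢ | yes refl = ⊥-elim (≢ refl)

  -- The row expansion inside det has no name of its own; the meta variable is solved by detRow-def.
  mutual
    detRow : ∀ {m} (M : Fin (suc m) → Fin (suc m) → Polynomial) → List (Fin (suc m)) → Bool → Polynomial
    detRow M = _

    detRow-def : ∀ {m} (M : Fin (suc m) → Fin (suc m) → Polynomial) →
      det M ≡ (M zero zero ⊗ det (λ r c′ → M (suc r) (punchIn zero c′))) ⊕ detRow M (Vec.toList (tabulate Fin.suc)) false
    detRow-def {m} M with Vec.toList (tabulate {n = m} Fin.suc) | false
    ... | js | s = refl

  module _ (char2 : 1# +ᴿ 1# ≈ 0#) where

    -1≈1 : - 1# ≈ 1#
    -1≈1 = ≈-sym (Algebra.Properties.Ring.+-inverseˡ-unique (CommutativeRing.ring R) 1# 1# char2)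

    ⊖-≋ : ∀ {p ms} → p ≋ ms → (⊖ p) ≋ ms
    ⊖-≋ [] = []
    ⊖-≋ ((a≈1 , refl) ∷ p≋) = (≈-trans (CommutativeRing.-‿cong R a≈1) -1≈1 , refl) ∷ ⊖-≋ p≋

    even⊠1≈0 : ∀ {k} → 2 ∣ k → k ⊠ 1# ≈ 0#
    even⊠1≈0 (divides zero refl) = ≈-refl
    even⊠1≈0 (divides (suc q) refl) =
      ≈-trans (≈-sym (CommutativeRing.+-assoc R _ _ _))
        (≈-trans (+-cong char2 (even⊠1≈0 (divides q refl))) (+-identityˡ 0#))

    -- Since `- 1# ≈ 1#`, the alternating signs disappear and the determinant is a permanent. Every
    -- entry has at most one term, so each permutation yields at most one monomial.
    det-≋ : ∀ {m} (M : Fin m → Fin m → Polynomial) (E : Fin m → Fin m → Maybe Monomial) →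
            (∀ i j → M i j ≋ fromMaybe (E i j)) →
            det M ≋ mapMaybe (λ σ → ∏ (λ i → E i (lookup σ i))) (perms m)
    det-≋ {zero} M E M≋ = (≈-refl , refl) ∷ []
    det-≋ {suc m} M E M≋ = row (Vec.toList (Vec.allFin (suc m))) true
      where
      W : Vec (Fin (suc m)) (suc m) → Maybe Monomial
      W σ = ∏ (λ i → E i (lookup σ i))
      term : ∀ j → M zero j ⊗ det (λ r c′ → M (suc r) (punchIn j c′)) ≋ mapMaybe W (map (insertHead j) (perms m))
      term j = subst (_ ≋_)
        (trans (Listₚ.mapMaybe-cong (λ τ → cong (E zero j ·_) (∏-cong (λ i → cong (E (suc i)) (sym (Vecₚ.lookup-map i (punchIn j) τ))))) (perms m))
               (sym (Listₚ.mapMaybe-map W (insertHead j) (perms m))))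
        (⊗-≋ {xs = perms m} (M≋ zero j) (det-≋ (λ r c′ → M (suc r) (punchIn j c′)) (λ r c′ → E (suc r) (punchIn j c′)) (λ r c′ → M≋ (suc r) (punchIn j c′))))
      row : ∀ js s → detRow M js s ≋ mapMaybe W (cartesianProductWith insertHead js (perms m))
      row [] s = []
      row (j ∷ js) true = subst (_ ≋_) (sym (Listₚ.mapMaybe-++ W (map (insertHead j) (perms m)) _))
        (Pointwise.++⁺ (term j) (row js false))
      row (j ∷ js) false = subst (_ ≋_) (sym (Listₚ.mapMaybe-++ W (map (insertHead j) (perms m)) _))
        (Pointwise.++⁺ (⊖-≋ (term j)) (row js true))

-- Iterates of an injective map and the cycles they trace.

least : ∀ {p} {P : ℕ → Set p} → Decidable P → ∀ {m} → P m → ∃ λ q → P q × (∀ {r} → r < q → ¬ P r)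
least {P = P} P? {m} = <-rec (λ m → P m → ∃ λ q → P q × (∀ {r} → r < q → ¬ P r)) step m
  where
  step : ∀ m → (∀ {r} → r < m → P r → _) → P m → _
  step m rec Pm with ℕₚ.anyUpTo? P? m
  ... | yes (r , r<m , Pr) = rec r<m Pr
  ... | no ¬smaller = m , Pm , λ {r} r<m Pr → ¬smaller (r , r<m , Pr)

fold-suc : ∀ {A : Set} (f : A → A) {x} i → fold x f (suc i) ≡ fold (f x) f i
fold-suc f zero = refl
fold-suc f (suc i) = cong f (fold-suc f i)

module _ {n} {f : Fin n → Fin n} (inj : Injective _≡_ _≡_ f) where

  fold-injective : ∀ i {x y} → fold x f i ≡ fold y f i → x ≡ y
  fold-injective zero eq = eq
  fold-injective (suc i) eq = fold-injective i (inj eq)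

  fold-cancel : ∀ i {d x} → fold x f i ≡ fold x f (i + d) → fold x f d ≡ x
  fold-cancel i {d} {x} eq = sym (fold-injective i (trans eq (fold-+ x f i)))

  -- Two of the first `n + 1` iterates coincide, and injectivity cancels their common beginning. The
  -- bound `p < n` later lets `orbit?` search only the iterates numbered by `Fin n`.
  period : ∀ x → ∃ λ p → p < n × fold x f (suc p) ≡ x
  period x with Finₚ.pigeonhole (ℕₚ.n<1+n n) (λ i → fold x f (toℕ i))
  ... | i , j , i<j , eq with d , i+d≡j ← ℕₚ.m≤n⇒∃[o]m+o≡n i<j =
    d , ℕₚ.≤-trans (ℕₚ.≤-trans (ℕₚ.m≤n+m (suc d) (toℕ i)) (ℕₚ.≤-reflexive i+sd≡j)) (Finₚ.toℕ≤pred[n] j)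
      , fold-cancel (toℕ i) (trans eq (cong (fold x f) (sym i+sd≡j)))
    where
    i+sd≡j : toℕ i + suc d ≡ toℕ j
    i+sd≡j = trans (ℕₚ.+-suc (toℕ i) d) i+d≡j

  fold-mod-period : ∀ {p x} → fold x f (suc p) ≡ x → ∀ i → ∃ λ j → j < suc p × fold x f j ≡ fold x f i
  fold-mod-period per zero = 0 , s≤s z≤n , refl
  fold-mod-period {p} per (suc i) with fold-mod-period per i
  ... | j , j≤p , eq with j ℕ.≟ p
  ...   | yes refl = 0 , s≤s z≤n , trans (sym per) (cong f eq)
  ...   | no j≢p = suc j , s≤s (ℕₚ.≤∧≢⇒< (ℕₚ.≤-pred j≤p) j≢p) , cong f eq

  orbit-pred : ∀ {x y} i → fold x f i ≡ f y → ∃ λ j → fold x f j ≡ y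
  orbit-pred (suc i) eq = i , inj eq
  -- Here `f y` is the starting point itself, so `y` is the last iterate before the orbit closes.
  orbit-pred {x} zero eq with p , _ , per ← period x = p , inj (trans per eq)

lastOf-applyUpTo : ∀ {A : Set} (g : ℕ → A) p → lastOf (g 0) (applyUpTo (g ∘ suc) p) ≡ g p
lastOf-applyUpTo g zero = refl
lastOf-applyUpTo g (suc p) = lastOf-applyUpTo (g ∘ suc) p

-- The cycle lists the iterates up to the least return to `x`; minimality makes them distinct. The
-- last two assumptions exclude periods 1 and 2, which are too short for a simple cycle.
orbit-isCycle : ∀ {n} (G : SimpleGraph n) {f : Fin n → Fin n} → Injective _≡_ _≡_ f → ∀ x →
  (∀ i → Adj G (fold x f i) (fold x f (suc i))) → f x ≢ x → f (f x) ≢ x →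
  ∃ λ cyc → IsCycle G cyc × (∀ i → fold x f i ∈ cyc)
orbit-isCycle G {f} inj x adj fx≢x ffx≢x
  with p₀ , _ , per₀ ← period inj x
  with least (λ p → fold x f (suc p) Finₚ.≟ x) {p₀} per₀
... | zero , per , _ = ⊥-elim (fx≢x per)
... | suc zero , per , _ = ⊥-elim (ffx≢x per)
... | p@(suc (suc _)) , per , min =
  applyUpTo (fold x f) (suc p)
  , ( subst (2 ≤_) (sym (Listₚ.length-applyUpTo (fold x f ∘ suc) p)) (s≤s (s≤s z≤n))
    , Uniqueₚ.applyUpTo⁺₁ (fold x f) (suc p) distinct
    , Linkedₚ.applyUpTo⁺₂ (fold x f) (suc p) adj
    , subst₂ (Adj G) (sym (lastOf-applyUpTo (fold x f) p)) per (adj p))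
  , λ i → let j , j<p , eq = fold-mod-period inj per i in subst (_∈ _) eq (∈ₚ.∈-applyUpTo⁺ (fold x f) j<p)
  where
  distinct : ∀ {i j} → i < j → j < suc p → fold x f i ≢ fold x f j
  distinct {i} i<j j≤p eq with d , refl ← ℕₚ.m≤n⇒∃[o]m+o≡n i<j =
    min {d} (ℕₚ.≤-trans (s≤s (ℕₚ.m≤n+m d i)) (ℕₚ.≤-pred j≤p))
      (fold-cancel inj i (trans eq (cong (fold x f) (sym (ℕₚ.+-suc i d)))))

-- Cycles of the graph as permutations of its vertices.

-- The fields use `cyc` only as a set of vertices. Hence the inverse permutation traverses the same
-- list, and a cycle can change direction without the list being reversed.
record TraversesCycle {n} (G : SimpleGraph n) (cyc : List (Fin n)) (f : Fin n → Fin n) : Set where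
  field
    injective  : Injective _≡_ _≡_ f
    adjacent   : ∀ {v} → v ∈ cyc → Adj G v (f v)
    fixed      : ∀ {v} → v ∉ cyc → f v ≡ v
    transitive : ∀ {u v} → u ∈ cyc → v ∈ cyc → ∃ λ i → fold u f i ≡ v

Adj-irrefl : ∀ {n} (G : SimpleGraph n) {u v} → Adj G u v → u ≢ v
Adj-irrefl G {u} adj refl with () ← trans (sym adj) (SimpleGraph.irrefl G u)

_∈?_ : ∀ {n} (v : Fin n) l → Dec (v ∈ l)
_∈?_ = DecMembership._∈?_ Finₚ._≟_

module _ {n : ℕ} where

  headOr : Fin n → List (Fin n) → Fin n
  headOr h []      = h
  headOr h (y ∷ _) = y

  -- The argument `h` remembers the head of the whole cycle while the recursion peels off vertices;
  -- it is the value at the last vertex. Off the list the map is the identity.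
  successor : Fin n → List (Fin n) → Fin n → Fin n
  successor h []       v = v
  successor h (y ∷ ys) v with v Finₚ.≟ y
  ... | yes _ = headOr h ys
  ... | no  _ = successor h ys v

  successor-head : ∀ h y ys → successor h (y ∷ ys) y ≡ headOr h ys
  successor-head h y ys with y Finₚ.≟ y
  ... | yes _ = refl
  ... | no ≢ = ⊥-elim (≢ refl)

  successor-tail : ∀ h {y v} ys → v ≢ y → successor h (y ∷ ys) v ≡ successor h ys v
  successor-tail h {y} {v} ys v≢y with v Finₚ.≟ y
  ... | yes eq = ⊥-elim (v≢y eq)
  ... | no _ = refl

  successor-∉ : ∀ h l {v} → v ∉ l → successor h l v ≡ v
  successor-∉ h [] _ = refl
  successor-∉ h (y ∷ ys) v∉ = trans (successor-tail h ys (v∉ ∘ here)) (successor-∉ h ys (v∉ ∘ there))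

  headOr-∈ : ∀ h ys → headOr h ys ∈ h ∷ ys
  headOr-∈ h [] = here refl
  headOr-∈ h (y ∷ ys) = there (here refl)

  successor-∈ : ∀ h y ys {v} → v ∈ y ∷ ys → successor h (y ∷ ys) v ∈ h ∷ ys
  successor-∈ h y ys {v} v∈ with v Finₚ.≟ y
  successor-∈ h y ys v∈ | yes _ = headOr-∈ h ys
  successor-∈ h y ys (here eq) | no ≢ = ⊥-elim (≢ eq)
  successor-∈ h y (z ∷ zs) (there v∈) | no _ with successor-∈ h z zs v∈
  ... | here eq = here eq
  ... | there ∈zs = there (there ∈zs)

  successor-adj : ∀ (G : SimpleGraph n) h y ys → Linked (Adj G) (y ∷ ys) → Adj G (lastOf y ys) h →
                  ∀ {v} → v ∈ y ∷ ys → Adj G v (successor h (y ∷ ys) v)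
  successor-adj G h y ys link last {v} v∈ with v Finₚ.≟ y
  successor-adj G h y [] link last v∈ | yes refl = last
  successor-adj G h y (z ∷ zs) (adj ∷ _) last v∈ | yes refl = adj
  successor-adj G h y ys link last (here eq) | no ≢ = ⊥-elim (≢ eq)
  successor-adj G h y (z ∷ zs) (_ ∷ link) last (there v∈) | no ≢ = successor-adj G h z zs link last v∈

  headOr≢successor : ∀ h ys → Unique ys → h ∉ ys → ∀ {v} → v ∈ ys → headOr h ys ≢ successor h ys v
  headOr≢successor h (z ∷ zs) (z∉ ∷ _) h∉ {v} v∈ eq with successor-∈ h z zs v∈
  ... | here eq′ = h∉ (here (sym (trans eq eq′)))
  ... | there ∈zs = All.lookup z∉ ∈zs eq

  -- Only `h ∉ ys` is demanded, because at the outermost call `h` is `y` itself. Two vertices with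
  -- the same successor could differ only if the head of `ys`, or `h`, were reached twice, which
  -- `headOr≢successor` excludes.
  successor-injective : ∀ h y ys → Unique (y ∷ ys) → h ∉ ys → ∀ {u v} → u ∈ y ∷ ys → v ∈ y ∷ ys →
    successor h (y ∷ ys) u ≡ successor h (y ∷ ys) v → u ≡ v
  successor-injective h y ys (_ ∷ uniq) h∉ {u} {v} u∈ v∈ eq with u Finₚ.≟ y | v Finₚ.≟ y
  successor-injective h y ys (_ ∷ uniq) h∉ u∈ v∈ eq | yes refl | yes refl = refl
  successor-injective h y ys (_ ∷ uniq) h∉ u∈ (here e) eq | yes _ | no ≢ = ⊥-elim (≢ e)
  successor-injective h y ys (_ ∷ uniq) h∉ u∈ (there v∈) eq | yes _ | no ≢ = ⊥-elim (headOr≢successor h ys uniq h∉ v∈ eq)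
  successor-injective h y ys (_ ∷ uniq) h∉ (here e) v∈ eq | no ≢ | _ = ⊥-elim (≢ e)
  successor-injective h y ys (_ ∷ uniq) h∉ (there u∈) v∈ eq | no ≢ | yes _ = ⊥-elim (headOr≢successor h ys uniq h∉ u∈ (sym eq))
  successor-injective h y ys (_ ∷ uniq) h∉ (there u∈) (here e) eq | no _ | no ≢ = ⊥-elim (≢ e)
  successor-injective h y (z ∷ zs) (_ ∷ uniq) h∉ (there u∈) (there v∈) eq | no _ | no _ =
    successor-injective h z zs uniq (h∉ ∘ there) u∈ v∈ eq

  -- The induction passes to suffixes while `f` remains the rotation of the whole cycle, so
  -- agreement with `successor` is assumed on the suffix only. Going from any vertex to `h` and from
  -- the head to any other gives transitivity.
  head-reaches : ∀ (f : Fin n → Fin n) h y ys → Unique (y ∷ ys) →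
    (∀ {v} → v ∈ y ∷ ys → f v ≡ successor h (y ∷ ys) v) →
    ∀ {v} → v ∈ y ∷ ys → (∃ λ i → fold y f i ≡ v) × (∃ λ i → fold v f i ≡ h)
  head-reaches f h y [] uniq f≡ (here refl) = (0 , refl) , (1 , trans (f≡ (here refl)) (successor-head h y []))
  head-reaches f h y (z ∷ zs) (y∉ ∷ uniq) f≡ {v} v∈ = go v∈
    where
    fy≡z : f y ≡ z
    fy≡z = trans (f≡ (here refl)) (successor-head h y (z ∷ zs))
    f≡′ : ∀ {v} → v ∈ z ∷ zs → f v ≡ successor h (z ∷ zs) v
    f≡′ v∈ = trans (f≡ (there v∈)) (successor-tail h (z ∷ zs) (λ v≡y → All.lookup y∉ v∈ (sym v≡y)))
    rec : ∀ {v} → v ∈ z ∷ zs → (∃ λ i → fold z f i ≡ v) × (∃ λ i → fold v f i ≡ h)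
    rec = head-reaches f h z zs uniq f≡′
    from-y : ∀ {w} → (∃ λ i → fold z f i ≡ w) → ∃ λ i → fold y f i ≡ w
    from-y (i , eq) = suc i , trans (fold-suc f i) (trans (cong (λ u → fold u f i) fy≡z) eq)
    go : v ∈ y ∷ z ∷ zs → _
    go (here refl) = (0 , refl) , from-y (proj₂ (rec (here refl)))
    go (there v∈) = from-y (proj₁ (rec v∈)) , proj₂ (rec v∈)

  cycle⇒traversal : ∀ (G : SimpleGraph n) cyc → IsCycle G cyc → ∃ λ f → TraversesCycle G cyc f
  cycle⇒traversal G (x ∷ xs) (_ , uniq@(x∉ ∷ _) , link , last) = f , record
    { injective = injective
    ; adjacent = successor-adj G x x xs link last
    ; fixed = successor-∉ x (x ∷ xs)
    ; transitive = λ u∈ v∈ →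
        let i , to-x = proj₂ (reach u∈); j , from-x = proj₁ (reach v∈)
        in j + i , trans (fold-+ _ f j) (trans (cong (λ w → fold w f j) to-x) from-x)
    }
    where
    f = successor x (x ∷ xs)
    reach : ∀ {v} → v ∈ x ∷ xs → (∃ λ i → fold x f i ≡ v) × (∃ λ i → fold v f i ≡ x)
    reach = head-reaches f x x xs uniq (λ _ → refl)
    injective : Injective _≡_ _≡_ f
    injective {u} {v} eq with u ∈? (x ∷ xs) | v ∈? (x ∷ xs)
    ... | yes u∈ | yes v∈ = successor-injective x x xs uniq (λ x∈ → All.lookup x∉ x∈ refl) u∈ v∈ eq
    ... | yes u∈ | no v∉ = ⊥-elim (v∉ (subst (_∈ x ∷ xs) (trans eq (successor-∉ x (x ∷ xs) v∉)) (successor-∈ x x xs u∈)))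
    ... | no u∉ | yes v∈ = ⊥-elim (u∉ (subst (_∈ x ∷ xs) (trans (sym eq) (successor-∉ x (x ∷ xs) u∉)) (successor-∈ x x xs v∈)))
    ... | no u∉ | no v∉ = trans (sym (successor-∉ x (x ∷ xs) u∉)) (trans eq (successor-∉ x (x ∷ xs) v∉))

  fold-inverse : ∀ {f g : Fin n → Fin n} → (∀ x → g (f x) ≡ x) → ∀ i x → fold (fold x f i) g i ≡ x
  fold-inverse gf zero x = refl
  fold-inverse {f} {g} gf (suc i) x = trans (fold-suc g i) (trans (cong (λ u → fold u g i) (gf _)) (fold-inverse gf i x))

  reverse-traversal : ∀ (G : SimpleGraph n) {cyc f g} → (∀ x → g (f x) ≡ x) → (∀ x → f (g x) ≡ x) →
                      TraversesCycle G cyc f → TraversesCycle G cyc g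
  reverse-traversal G {cyc} {f} {g} gf fg trav = record
    { injective = λ {x} {y} eq → trans (sym (fg x)) (trans (cong f eq) (fg y))
    ; adjacent = adj
    ; fixed = λ {v} v∉ → trans (cong g (sym (T.fixed v∉))) (gf v)
    ; transitive = λ {u} {v} u∈ v∈ → let i , eq = T.transitive v∈ u∈ in
        i , trans (cong (λ w → fold w g i) (sym eq)) (fold-inverse gf i v)
    }
    where
    module T = TraversesCycle trav
    adj : ∀ {v} → v ∈ cyc → Adj G v (g v)
    adj {v} v∈ with g v ∈? cyc
    ... | yes gv∈ = trans (SimpleGraph.sym G v (g v)) (subst (Adj G (g v)) (fg v) (T.adjacent gv∈))
    ... | no gv∉ = ⊥-elim (gv∉ (subst (_∈ cyc) (trans (sym (fg v)) (T.fixed gv∉)) v∈))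

-- Reversing a permutation off an orbit

module _ {n} (f : Fin n → Fin n) where

  -- Only meaningful on the image of f; elsewhere it returns its argument.
  inverseOf : Fin n → Fin n
  inverseOf y with Finₚ.any? (λ x → f x Finₚ.≟ y)
  ... | yes (x , _) = x
  ... | no _ = y

  inverseOf-image : ∀ {x y} → f x ≡ y → f (inverseOf y) ≡ y
  inverseOf-image {x} {y} eq with Finₚ.any? (λ x → f x Finₚ.≟ y)
  ... | yes (_ , fx≡y) = fx≡y
  ... | no ∄ = ⊥-elim (∄ (x , eq))

  -- The second argument is a number and not a vertex because the same test steers `toggle`, which
  -- runs over positions of an orientation.
  orbit? : Fin n → ℕ → Bool
  orbit? x a = does (Finₚ.any? λ (i : Fin n) → toℕ (fold x f (toℕ i)) ℕ.≟ a)

  module _ (inj : Injective _≡_ _≡_ f) where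

    inverseOf-right : ∀ y → f (inverseOf y) ≡ y
    inverseOf-right y with p , _ , per ← period inj y = inverseOf-image per

    inverseOf-left : ∀ x → inverseOf (f x) ≡ x
    inverseOf-left x = inj (inverseOf-right (f x))

    orbit?-sound : ∀ x {y} → orbit? x (toℕ y) ≡ true → ∃ λ i → fold x f i ≡ y
    orbit?-sound x {y} eq with Finₚ.any? (λ (i : Fin n) → toℕ (fold x f (toℕ i)) ℕ.≟ toℕ y)
    ... | yes (i , e) = toℕ i , Finₚ.toℕ-injective e

    orbit?-complete : ∀ x {a} i → toℕ (fold x f i) ≡ a → orbit? x a ≡ true
    orbit?-complete x {a} i eq with Finₚ.any? (λ (i : Fin n) → toℕ (fold x f (toℕ i)) ℕ.≟ a)
    ... | yes _ = refl
    ... | no ∄ with p , p<n , per ← period inj x with j , j≤p , e ← fold-mod-period inj per i =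
      ⊥-elim (∄ (Fin.fromℕ< j<n , trans (cong (λ i → toℕ (fold x f i)) (Finₚ.toℕ-fromℕ< j<n)) (trans (cong toℕ e) eq)))
      where j<n = ℕₚ.≤-trans j≤p p<n

    orbit?-invariant : ∀ x y → orbit? x (toℕ (f y)) ≡ orbit? x (toℕ y)
    orbit?-invariant x y = Boolₚ.⇔→≡ {z = true} (mk⇔
      (λ eq → let i , e = orbit?-sound x eq; j , e′ = orbit-pred inj i e in orbit?-complete x j (cong toℕ e′))
      (λ eq → let i , e = orbit?-sound x eq in orbit?-complete x (suc i) (cong (toℕ ∘ f) e)))

  reflectOff : (ℕ → Bool) → Fin n → Fin n
  reflectOff O x = if O (toℕ x) then f x else inverseOf x

module _ {n} {f : Fin n → Fin n} (inj : Injective _≡_ _≡_ f)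
         (O : ℕ → Bool) (O-invariant : ∀ x → O (toℕ (f x)) ≡ O (toℕ x)) where

  private
    inv = inverseOf f
    invʳ = inverseOf-right f inj
    invˡ = inverseOf-left f inj

  O-inverse : ∀ x → O (toℕ (inv x)) ≡ O (toℕ x)
  O-inverse x = trans (sym (O-invariant (inv x))) (cong (O ∘ toℕ) (invʳ x))

  reflectOff-on : ∀ {x} → O (toℕ x) ≡ true → reflectOff f O x ≡ f x
  reflectOff-on eq rewrite eq = refl

  reflectOff-off : ∀ {x} → O (toℕ x) ≡ false → reflectOff f O x ≡ inv x
  reflectOff-off eq rewrite eq = refl

  reflectOff-injective : Injective _≡_ _≡_ (reflectOff f O)
  reflectOff-injective {x} {y} eq with O (toℕ x) in Ox | O (toℕ y) in Oy
  ... | true | true = inj eq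
  ... | false | false = trans (sym (invʳ x)) (trans (cong f eq) (invʳ y))
  ... | true | false with () ← trans (sym Ox) (trans (sym (O-invariant x)) (trans (cong (O ∘ toℕ) eq) (trans (O-inverse y) Oy)))
  ... | false | true with () ← trans (sym Ox) (trans (sym (O-inverse x)) (trans (cong (O ∘ toℕ) eq) (trans (O-invariant y) Oy)))

  -- The second reflection works with a tabulated permutation and with its recomputed orbit; both
  -- are known only pointwise, hence `f′` and `O′`.
  reflectOff-involutive : ∀ {f′ O′} → (∀ x → f′ x ≡ reflectOff f O x) → (∀ a → O′ a ≡ O a) →
                          ∀ x → reflectOff f′ O′ x ≡ f x
  reflectOff-involutive {f′} {O′} f′≗ O′≗ x rewrite O′≗ (toℕ x) with O (toℕ x) in Ox
  ... | true = trans (f′≗ x) (reflectOff-on Ox)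
  ... | false = trans (cong (inverseOf f′) (sym f′fx≡x)) (inverseOf-left f′ f′-injective (f x))
    where
    f′-injective : Injective _≡_ _≡_ f′
    f′-injective {u} {v} eq = reflectOff-injective (trans (sym (f′≗ u)) (trans eq (f′≗ v)))
    f′fx≡x : f′ (f x) ≡ x
    f′fx≡x = trans (f′≗ (f x)) (trans (reflectOff-off (trans (O-invariant x) Ox)) (invˡ x))

  -- Reindexing along this permutation turns the arcs of the reflected permutation into those of f.
  shiftOff : Permutation′ n
  shiftOff = permutation to from to∘from from∘to
    where
    to from : Fin n → Fin n
    to x = if O (toℕ x) then x else f x
    from x = if O (toℕ x) then x else inv x
    to∘from : ∀ x → to (from x) ≡ x
    to∘from x with O (toℕ x) in Ox
    ... | true rewrite Ox = refl
    ... | false rewrite trans (O-inverse x) Ox = invʳ x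
    from∘to : ∀ x → from (to x) ≡ x
    from∘to x with O (toℕ x) in Ox
    ... | true rewrite Ox = refl
    ... | false rewrite trans (O-invariant x) Ox = invˡ x

fold-agree : ∀ {n} {f g : Fin n → Fin n} x → (∀ i → g (fold x f i) ≡ f (fold x f i)) → ∀ i → fold x g i ≡ fold x f i
fold-agree x agree zero = refl
fold-agree {g = g} x agree (suc i) = trans (cong g (fold-agree x agree i)) (agree i)

-- Along the orbit of `x` the reflected map agrees with `f`, so it has the same iterates. Thus
-- reversing twice splits the vertices in the same way both times.
orbit?-reflectOff : ∀ {n} {f f′ : Fin n → Fin n} → Injective _≡_ _≡_ f → ∀ x →
  (∀ y → f′ y ≡ reflectOff f (orbit? f x) y) → ∀ a → orbit? f′ x a ≡ orbit? f x a
orbit?-reflectOff {n} {f} {f′} inj x f′≗ a = does-⇔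
  (mk⇔ (λ (i , e) → i , trans (cong toℕ (sym (fold≡ (toℕ i)))) e) (λ (i , e) → i , trans (cong toℕ (fold≡ (toℕ i))) e))
  (Finₚ.any? λ (i : Fin n) → toℕ (fold x f′ (toℕ i)) ℕ.≟ a) (Finₚ.any? λ (i : Fin n) → toℕ (fold x f (toℕ i)) ℕ.≟ a)
  where
  fold≡ : ∀ i → fold x f′ i ≡ fold x f i
  fold≡ = fold-agree x (λ i → trans (f′≗ (fold x f i))
    (reflectOff-on inj (orbit? f x) (orbit?-invariant f inj x) (orbit?-complete f inj x i refl)))

-- Orientations

toggle : (ℕ → Bool) → List Bool → List Bool
toggle f []      = []
toggle f (b ∷ o) = (b xor f 0) ∷ toggle (f ∘ suc) o

length-toggle : ∀ f o → length (toggle f o) ≡ length o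
length-toggle f [] = refl
length-toggle f (b ∷ o) = cong suc (length-toggle (f ∘ suc) o)

lookupB-toggle : ∀ f o {i} → i < length o → lookupB (toggle f o) i ≡ lookupB o i xor f i
lookupB-toggle f (b ∷ o) {zero} _ = refl
lookupB-toggle f (b ∷ o) {suc i} (s≤s i<) = lookupB-toggle (f ∘ suc) o i<

toggle-involutive : ∀ {f g} o → (∀ i → g i ≡ f i) → toggle g (toggle f o) ≡ o
toggle-involutive [] g≗f = refl
toggle-involutive {f} {g} (b ∷ o) g≗f = cong₂ _∷_
  (trans (cong ((b xor f 0) xor_) (g≗f 0)) (trans (Boolₚ.xor-assoc b (f 0) (f 0)) (trans (cong (b xor_) (Boolₚ.xor-same (f 0))) (Boolₚ.xor-identityʳ b))))
  (toggle-involutive o (g≗f ∘ suc))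

toggle-fixed : ∀ f o → toggle f o ≡ o → ∀ {i} → i < length o → f i ≡ false
toggle-fixed f (true ∷ o) eq {zero} _ with f 0
... | false = refl
... | true with () ← eq
toggle-fixed f (false ∷ o) eq {zero} _ with f 0
... | false = refl
... | true with () ← eq
toggle-fixed f (b ∷ o) eq {suc i} (s≤s i<) = toggle-fixed (f ∘ suc) o (Data.List.Properties.∷-injectiveʳ eq) i<
  where import Data.List.Properties

module _ (k : ℕ) where

  -- These are the neighbour from which a vertex of K may not be entered and the neighbour to which
  -- it may not be left. They are always the two different neighbours, so the permitted passage
  -- enters from `wrongOut` and leaves to `wrongIn`; flipping the bit exchanges them.
  wrongIn wrongOut : List Bool → ℕ → ℕ
  wrongIn  o b = if lookupB o (b ∸ 1) then k + 2 * b + 1 else k + 2 * b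
  wrongOut o a = if lookupB o (a ∸ 1) then k + 2 * a else k + 2 * a + 1

  Forbidden : List Bool → ℕ → ℕ → Set
  Forbidden o a b =
    (a ≡ 0 × b ≡ suc k) ⊎ (a ≡ k × b ≡ 0) ⊎ ((0 < b × b < k) × a ≡ wrongIn o b) ⊎ ((0 < a × a < k) × b ≡ wrongOut o a)

  private
    ∧⁻ : ∀ {x y} → T (x ∧ y) → T x × T y
    ∧⁻ = Equivalence.to Boolₚ.T-∧
    ∧⁺ : ∀ {x y} → T x × T y → T (x ∧ y)
    ∧⁺ = Equivalence.from Boolₚ.T-∧
    ∨⁻ : ∀ {x y} → T (x ∨ y) → T x ⊎ T y
    ∨⁻ = Equivalence.to Boolₚ.T-∨
    ∨⁺ : ∀ {x y} → T x ⊎ T y → T (x ∨ y)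
    ∨⁺ = Equivalence.from Boolₚ.T-∨

  zeroed⇒forbidden : ∀ o a b → T (zeroed k o a b) → Forbidden o a b
  zeroed⇒forbidden o a b t with ∨⁻ {(a ≡ᵇ 0) ∧ (b ≡ᵇ suc k)} t
  ... | inj₁ p = let x , y = ∧⁻ {a ≡ᵇ 0} p in inj₁ (ℕₚ.≡ᵇ⇒≡ a 0 x , ℕₚ.≡ᵇ⇒≡ b (suc k) y)
  ... | inj₂ t′ with ∨⁻ {(a ≡ᵇ k) ∧ (b ≡ᵇ 0)} t′
  ...   | inj₁ p = let x , y = ∧⁻ {a ≡ᵇ k} p in inj₂ (inj₁ (ℕₚ.≡ᵇ⇒≡ a k x , ℕₚ.≡ᵇ⇒≡ b 0 y))
  ...   | inj₂ t″ with ∨⁻ {((0 <ᵇ b) ∧ (b <ᵇ k)) ∧ (a ≡ᵇ wrongIn o b)} t″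
  ...     | inj₁ p = let x , y = ∧⁻ {(0 <ᵇ b) ∧ (b <ᵇ k)} p ; u , v = ∧⁻ {0 <ᵇ b} x in
                     inj₂ (inj₂ (inj₁ ((ℕₚ.<ᵇ⇒< 0 b u , ℕₚ.<ᵇ⇒< b k v) , ℕₚ.≡ᵇ⇒≡ a (wrongIn o b) y)))
  ...     | inj₂ p = let x , y = ∧⁻ {(0 <ᵇ a) ∧ (a <ᵇ k)} p ; u , v = ∧⁻ {0 <ᵇ a} x in
                     inj₂ (inj₂ (inj₂ ((ℕₚ.<ᵇ⇒< 0 a u , ℕₚ.<ᵇ⇒< a k v) , ℕₚ.≡ᵇ⇒≡ b (wrongOut o a) y)))

  forbidden⇒zeroed : ∀ o a b → Forbidden o a b → T (zeroed k o a b)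
  forbidden⇒zeroed o a b (inj₁ (x , y)) =
    ∨⁺ {(a ≡ᵇ 0) ∧ (b ≡ᵇ suc k)} (inj₁ (∧⁺ {a ≡ᵇ 0} (ℕₚ.≡⇒≡ᵇ a 0 x , ℕₚ.≡⇒≡ᵇ b (suc k) y)))
  forbidden⇒zeroed o a b (inj₂ (inj₁ (x , y))) =
    ∨⁺ {(a ≡ᵇ 0) ∧ (b ≡ᵇ suc k)} (inj₂ (∨⁺ {(a ≡ᵇ k) ∧ (b ≡ᵇ 0)} (inj₁ (∧⁺ {a ≡ᵇ k} (ℕₚ.≡⇒≡ᵇ a k x , ℕₚ.≡⇒≡ᵇ b 0 y)))))
  forbidden⇒zeroed o a b (inj₂ (inj₂ (inj₁ ((u , v) , y)))) =
    ∨⁺ {(a ≡ᵇ 0) ∧ (b ≡ᵇ suc k)} (inj₂ (∨⁺ {(a ≡ᵇ k) ∧ (b ≡ᵇ 0)} (inj₂ (∨⁺ {((0 <ᵇ b) ∧ (b <ᵇ k)) ∧ (a ≡ᵇ wrongIn o b)}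
      (inj₁ (∧⁺ {(0 <ᵇ b) ∧ (b <ᵇ k)} (∧⁺ {0 <ᵇ b} (ℕₚ.<⇒<ᵇ u , ℕₚ.<⇒<ᵇ v) , ℕₚ.≡⇒≡ᵇ a (wrongIn o b) y)))))))
  forbidden⇒zeroed o a b (inj₂ (inj₂ (inj₂ ((u , v) , y)))) =
    ∨⁺ {(a ≡ᵇ 0) ∧ (b ≡ᵇ suc k)} (inj₂ (∨⁺ {(a ≡ᵇ k) ∧ (b ≡ᵇ 0)} (inj₂ (∨⁺ {((0 <ᵇ b) ∧ (b <ᵇ k)) ∧ (a ≡ᵇ wrongIn o b)}
      (inj₂ (∧⁺ {(0 <ᵇ a) ∧ (a <ᵇ k)} (∧⁺ {0 <ᵇ a} (ℕₚ.<⇒<ᵇ u , ℕₚ.<⇒<ᵇ v) , ℕₚ.≡⇒≡ᵇ b (wrongOut o a) y)))))))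

  -- Vertices without an orientation bit satisfy both conditions vacuously, so both ends of an arc
  -- can be treated alike, in K or not.
  SameAt OppositeAt : List Bool → List Bool → ℕ → Set
  SameAt o o′ c     = 0 < c → c < k → lookupB o′ (c ∸ 1) ≡ lookupB o (c ∸ 1)
  OppositeAt o o′ c = 0 < c → c < k → lookupB o′ (c ∸ 1) ≡ not (lookupB o (c ∸ 1))

  forbidden-same : ∀ {o o′ a b} → SameAt o o′ a → SameAt o o′ b → Forbidden o a b → Forbidden o′ a b
  forbidden-same sa sb (inj₁ p) = inj₁ p
  forbidden-same sa sb (inj₂ (inj₁ p)) = inj₂ (inj₁ p)
  forbidden-same sa sb (inj₂ (inj₂ (inj₁ ((u , v) , y)))) rewrite sym (sb u v) = inj₂ (inj₂ (inj₁ ((u , v) , y)))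
  forbidden-same sa sb (inj₂ (inj₂ (inj₂ ((u , v) , y)))) rewrite sym (sa u v) = inj₂ (inj₂ (inj₂ ((u , v) , y)))

  if-not : ∀ {a} {A : Set a} {b b′} → b′ ≡ not b → {x y : A} → (if b then x else y) ≡ (if b′ then y else x)
  if-not {b = true} refl = refl
  if-not {b = false} refl = refl

  -- Flipping the bits turns a forbidden entrance into a forbidden exit, so the third and fourth
  -- kinds of arc are transposed into each other. The two arcs forbidden at index 0 have no such
  -- counterpart and are excluded by assumption.
  forbidden-opposite : ∀ {o o′ a b} → a ≢ 0 → b ≢ 0 → OppositeAt o o′ a → OppositeAt o o′ b → Forbidden o a b → Forbidden o′ b a
  forbidden-opposite a≢0 b≢0 oa ob (inj₁ (p , _)) = ⊥-elim (a≢0 p)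
  forbidden-opposite a≢0 b≢0 oa ob (inj₂ (inj₁ (_ , p))) = ⊥-elim (b≢0 p)
  forbidden-opposite a≢0 b≢0 oa ob (inj₂ (inj₂ (inj₁ ((u , v) , y)))) = inj₂ (inj₂ (inj₂ ((u , v) , trans y (if-not (ob u v)))))
  forbidden-opposite a≢0 b≢0 oa ob (inj₂ (inj₂ (inj₂ ((u , v) , y)))) = inj₂ (inj₂ (inj₁ ((u , v) , trans y (if-not (oa u v)))))

  zeroed-≡ : ∀ {o o′ a b a′ b′} → (Forbidden o a b → Forbidden o′ a′ b′) → (Forbidden o′ a′ b′ → Forbidden o a b) →
             zeroed k o a b ≡ zeroed k o′ a′ b′
  zeroed-≡ {o} {o′} {a} {b} {a′} {b′} to from = Boolₚ.⇔→≡ {z = true} (mk⇔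
    (λ eq → Equivalence.to Boolₚ.T-≡ (forbidden⇒zeroed o′ a′ b′ (to (zeroed⇒forbidden o a b (Equivalence.from Boolₚ.T-≡ eq)))))
    (λ eq → Equivalence.to Boolₚ.T-≡ (forbidden⇒zeroed o a b (from (zeroed⇒forbidden o′ a′ b′ (Equivalence.from Boolₚ.T-≡ eq))))))

  zeroed-same : ∀ {o o′ a b} → SameAt o o′ a → SameAt o o′ b → zeroed k o a b ≡ zeroed k o′ a b
  zeroed-same {o} {o′} {a} {b} sa sb = zeroed-≡ {o} {o′} {a} {b} {a} {b} (forbidden-same {o} {o′} {a} {b} sa sb)
    (forbidden-same {o′} {o} {a} {b} (λ u v → sym (sa u v)) (λ u v → sym (sb u v)))

  not-swap : ∀ {x y} → x ≡ not y → y ≡ not x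
  not-swap {y = y} refl = sym (Boolₚ.not-involutive y)

  zeroed-opposite : ∀ {o o′ a b} → a ≢ 0 → b ≢ 0 → OppositeAt o o′ a → OppositeAt o o′ b → zeroed k o a b ≡ zeroed k o′ b a
  zeroed-opposite {o} {o′} {a} {b} a≢0 b≢0 oa ob = zeroed-≡ {o} {o′} {a} {b} {b} {a} (forbidden-opposite {o} {o′} {a} {b} a≢0 b≢0 oa ob)
    (forbidden-opposite {o′} {o} {b} {a} b≢0 a≢0 (λ u v → not-swap (ob u v)) (λ u v → not-swap (oa u v)))

-- Sums of natural numbers.

summand≤∑ : ∀ {n} (f : Fin n → ℕ) i → f i ≤ ∑ f
summand≤∑ f zero = ℕₚ.m≤m+n (f zero) _
summand≤∑ f (suc i) = ℕₚ.≤-trans (summand≤∑ (f ∘ suc) i) (ℕₚ.m≤n+m _ (f zero))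

two-summands≤∑ : ∀ {n} (f : Fin n → ℕ) {i j} → i ≢ j → f i + f j ≤ ∑ f
two-summands≤∑ f {zero} {zero} i≢j = ⊥-elim (i≢j refl)
two-summands≤∑ f {zero} {suc j} _ = ℕₚ.+-monoʳ-≤ (f zero) (summand≤∑ (f ∘ suc) j)
two-summands≤∑ f {suc i} {zero} _ rewrite ℕₚ.+-comm (f (suc i)) (f zero) = ℕₚ.+-monoʳ-≤ (f zero) (summand≤∑ (f ∘ suc) i)
two-summands≤∑ f {suc i} {suc j} i≢j = ℕₚ.≤-trans (two-summands≤∑ (f ∘ suc) (i≢j ∘ cong suc)) (ℕₚ.m≤n+m _ (f zero))

∑-positive : ∀ {n} (f : Fin n → ℕ) → 1 ≤ ∑ f → ∃ λ i → 1 ≤ f i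
∑-positive {suc n} f pos with f zero in eq
... | suc _ = zero , subst (1 ≤_) (sym eq) (s≤s z≤n)
... | zero with i , p ← ∑-positive (f ∘ suc) pos = suc i , p

∑≥2 : ∀ {n} (f : Fin n → ℕ) → (∀ i → f i ≤ 1) → 2 ≤ ∑ f → ∃ λ i → ∃ λ j → i ≢ j × 1 ≤ f i × 1 ≤ f j
∑≥2 {suc n} f f≤1 two with f zero in eq | f≤1 zero
... | suc zero | _ with j , p ← ∑-positive (f ∘ suc) (ℕₚ.≤-pred two) = zero , suc j , (λ ()) , ℕₚ.≤-reflexive (sym eq) , p
... | suc (suc _) | s≤s ()
... | zero | _ with i , j , i≢j , p , q ← ∑≥2 (f ∘ suc) (f≤1 ∘ suc) two = suc i , suc j , i≢j ∘ Finₚ.suc-injective , p , q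

-- Matrix entries, weights of pairs, and the reversal off the orbit.

module Weights {c ℓ} (R : CommutativeRing c ℓ) {n : ℕ} (G : SimpleGraph n) (k : ℕ) where
  open Poly R n
  open MG R G k
  open TermExpansion R n

  edgeMon : Fin n → Fin n → Monomial
  edgeMon a b = if toℕ a <ᵇ toℕ b then monVar a b else monVar b a

  entry₀ : Fin n → Fin n → Maybe Monomial
  entry₀ a b with toℕ a ℕ.≟ toℕ b
  ... | yes _ = if toℕ a <ᵇ 3 * k then nothing else just mon1
  ... | no  _ = if SimpleGraph.adj G a b then just (edgeMon a b) else nothing

  entry : List Bool → Fin n → Fin n → Maybe Monomial
  entry o a b = if zeroed k o (toℕ a) (toℕ b) then nothing else entry₀ a b

  Mo-≋ : ∀ o a b → Mo o a b ≋ fromMaybe (entry o a b)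
  Mo-≋ o a b with zeroed k o (toℕ a) (toℕ b)
  ... | true = []
  ... | false with toℕ a ℕ.≟ toℕ b
  Mo-≋ o a b | false | yes _ with toℕ a <ᵇ 3 * k
  ... | true = []
  ... | false = (CommutativeRing.refl R , refl) ∷ []
  Mo-≋ o a b | false | no _ with SimpleGraph.adj G a b
  ... | false = []
  ... | true with toℕ a <ᵇ toℕ b
  ...   | true = (CommutativeRing.refl R , refl) ∷ []
  ...   | false = (CommutativeRing.refl R , refl) ∷ []

  <ᵇ-true : ∀ {a b} → a < b → (a <ᵇ b) ≡ true
  <ᵇ-true a<b = Equivalence.to Boolₚ.T-≡ (ℕₚ.<⇒<ᵇ a<b)

  <ᵇ-false : ∀ {a b} → b ≤ a → (a <ᵇ b) ≡ false
  <ᵇ-false {a} {b} b≤a with a <ᵇ b in eq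
  ... | false = refl
  ... | true = ⊥-elim (ℕₚ.<⇒≱ (ℕₚ.<ᵇ⇒< a b (Equivalence.from Boolₚ.T-≡ eq)) b≤a)

  edgeMon-sym : ∀ {a b} → toℕ a ≢ toℕ b → edgeMon a b ≡ edgeMon b a
  edgeMon-sym {a} {b} a≢b with ℕₚ.<-cmp (toℕ a) (toℕ b)
  ... | tri< a<b _ _ rewrite <ᵇ-true a<b | <ᵇ-false (ℕₚ.<⇒≤ a<b) = refl
  ... | tri≈ _ a≡b _ = ⊥-elim (a≢b a≡b)
  ... | tri> _ _ b<a rewrite <ᵇ-true b<a | <ᵇ-false (ℕₚ.<⇒≤ b<a) = refl

  entry₀-sym : ∀ a b → entry₀ a b ≡ entry₀ b a
  entry₀-sym a b with toℕ a ℕ.≟ toℕ b | toℕ b ℕ.≟ toℕ a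
  ... | yes a≡b | yes _ rewrite a≡b = refl
  ... | yes a≡b | no b≢a = ⊥-elim (b≢a (sym a≡b))
  ... | no a≢b | yes b≡a = ⊥-elim (a≢b (sym b≡a))
  ... | no a≢b | no _ rewrite SimpleGraph.sym G a b | edgeMon-sym {a} {b} a≢b = refl

  data EntryView (o : List Bool) (a b : Fin n) (μ : Monomial) : Set where
    loop : a ≡ b → 3 * k ≤ toℕ a → μ ≡ mon1 → EntryView o a b μ
    arc  : a ≢ b → Adj G a b → ¬ Forbidden k o (toℕ a) (toℕ b) → μ ≡ edgeMon a b → EntryView o a b μ

  entryView : ∀ o a b {μ} → entry o a b ≡ just μ → EntryView o a b μ
  entryView o a b eq with zeroed k o (toℕ a) (toℕ b) in z
  ... | false with toℕ a ℕ.≟ toℕ b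
  entryView o a b eq | false | yes a≡b with toℕ a <ᵇ 3 * k in lt
  entryView o a b refl | false | yes a≡b | false =
    loop (Finₚ.toℕ-injective a≡b) (ℕₚ.≮⇒≥ (λ a<3k → Boolₚ.not-¬ (<ᵇ-true a<3k) lt)) refl
  entryView o a b eq | false | no a≢b with SimpleGraph.adj G a b in adj
  entryView o a b refl | false | no a≢b | true =
    arc (a≢b ∘ cong toℕ) adj
      (λ forb → Boolₚ.not-¬ (Equivalence.to Boolₚ.T-≡ (forbidden⇒zeroed k o (toℕ a) (toℕ b) forb)) z) refl

  entry-loop : ∀ o a → 3 * k ≤ toℕ a → ¬ Forbidden k o (toℕ a) (toℕ a) → entry o a a ≡ just mon1
  entry-loop o a 3k≤a ok with zeroed k o (toℕ a) (toℕ a) in z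
  ... | true = ⊥-elim (ok (zeroed⇒forbidden k o _ _ (Equivalence.from Boolₚ.T-≡ z)))
  ... | false with toℕ a ℕ.≟ toℕ a
  ...   | no a≢a = ⊥-elim (a≢a refl)
  ...   | yes _ rewrite <ᵇ-false 3k≤a = refl

  entry-arc : ∀ o a b → a ≢ b → Adj G a b → ¬ Forbidden k o (toℕ a) (toℕ b) → entry o a b ≡ just (edgeMon a b)
  entry-arc o a b a≢b adj ok with zeroed k o (toℕ a) (toℕ b) in z
  ... | true = ⊥-elim (ok (zeroed⇒forbidden k o _ _ (Equivalence.from Boolₚ.T-≡ z)))
  ... | false with toℕ a ℕ.≟ toℕ b
  ...   | yes a≡b = ⊥-elim (a≢b (Finₚ.toℕ-injective a≡b))
  ...   | no _ rewrite adj = refl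

  entry-same : ∀ {o o′} a b → SameAt k o o′ (toℕ a) → SameAt k o o′ (toℕ b) → entry o a b ≡ entry o′ a b
  entry-same {o} {o′} a b sa sb = cong (λ z → if z then nothing else entry₀ a b) (zeroed-same k {o} {o′} {toℕ a} {toℕ b} sa sb)

  entry-opposite : ∀ {o o′} a b → toℕ a ≢ 0 → toℕ b ≢ 0 → OppositeAt k o o′ (toℕ a) → OppositeAt k o o′ (toℕ b) →
                   entry o a b ≡ entry o′ b a
  entry-opposite {o} {o′} a b a≢0 b≢0 oa ob = cong₂ (λ z e → if z then nothing else e)
    (zeroed-opposite k {o} {o′} {toℕ a} {toℕ b} a≢0 b≢0 oa ob) (entry₀-sym a b)

  weight : List Bool × Vec (Fin n) n → Maybe Monomial
  weight (o , σ) = ∏ (λ i → entry o i (lookup σ i))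

  ∏-factors : ∀ {m} (t : Fin m → Maybe Monomial) {μ} → ∏ t ≡ just μ → ∃ λ (μs : Fin m → Monomial) →
    (∀ i → t i ≡ just (μs i)) × (∀ p q → lookup (lookup μ p) q ≡ ∑ λ i → lookup (lookup (μs i) p) q)
  ∏-factors {zero} t refl = (λ ()) , (λ ()) , λ p q →
    trans (cong (λ row → lookup row q) (Vecₚ.lookup-replicate p (Vec.replicate n 0))) (Vecₚ.lookup-replicate q 0)
  ∏-factors {suc m} t eq with t zero in t₀ | ∏ (t ∘ suc) in ts
  ∏-factors {suc m} t refl | just ν | just ν′ with μs , t≡ , exps ← ∏-factors (t ∘ suc) ts =
    (λ { zero → ν ; (suc i) → μs i }) , (λ { zero → t₀ ; (suc i) → t≡ i }) , λ p q →
      trans (cong (λ row → lookup row q) (Vecₚ.lookup-zipWith (Vec.zipWith _+_) p ν ν′))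
        (trans (Vecₚ.lookup-zipWith _+_ q (lookup ν p) (lookup ν′ p)) (cong (lookup (lookup ν p) q +_) (exps p q)))

  ∏-total : ∀ {m} (t : Fin m → Maybe Monomial) → (∀ i → ∃ λ μ → t i ≡ just μ) → ∃ λ μ → ∏ t ≡ just μ
  ∏-total {zero} t t≡ = mon1 , refl
  ∏-total {suc m} t t≡ with μ , e ← t≡ zero | ν , e′ ← ∏-total (t ∘ suc) (t≡ ∘ suc) = monMul μ ν , cong₂ _·_ e e′

  weight-view : ∀ o σ {μ} → weight (o , σ) ≡ just μ → ∀ i → ∃ (EntryView o i (lookup σ i))
  weight-view o σ eq i with μs , t≡ , _ ← ∏-factors (λ i → entry o i (lookup σ i)) eq = μs i , entryView o i (lookup σ i) (t≡ i)

  configurations : List (List Bool × Vec (Fin n) n)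
  configurations = cartesianProduct (allBoolLists (k ∸ 1)) (perms n)

  configurations-unique : Unique configurations
  configurations-unique = Uniqueₚ.cartesianProduct⁺ (allBoolLists-unique (k ∸ 1)) (perms-unique n)

  withWeight : Monomial → List (List Bool × Vec (Fin n) n)
  withWeight m = filter (λ s → weight s ≟ᵀ just m) configurations

  module _ (v₀ : Fin n) (v₀≡0 : toℕ v₀ ≡ 0) where

    onOrbit : Vec (Fin n) n → ℕ → Bool
    onOrbit σ = orbit? (lookup σ) v₀

    reverseOffOrbit : List Bool × Vec (Fin n) n → List Bool × Vec (Fin n) n
    -- Position `i` of an orientation belongs to the vertex with index `suc i`, as index 0 has no
    -- choice.
    reverseOffOrbit (o , σ) = toggle (λ i → not (onOrbit σ (suc i))) o , tabulate (reflectOff (lookup σ) (onOrbit σ))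

    module _ {σ : Vec (Fin n) n} (inj : InjectiveVec σ) where

      private
        O : ℕ → Bool
        O = onOrbit σ
        f = lookup σ
        inv = orbit?-invariant f inj v₀

      reverse-lookup : ∀ o x → lookup (proj₂ (reverseOffOrbit (o , σ))) x ≡ reflectOff f O x
      reverse-lookup o = Vecₚ.lookup∘tabulate (reflectOff f O)

      onOrbit-v₀ : O 0 ≡ true
      onOrbit-v₀ = orbit?-complete f inj v₀ 0 v₀≡0

      reverse-injective : ∀ o → InjectiveVec (proj₂ (reverseOffOrbit (o , σ)))
      reverse-injective o {x} {y} eq = reflectOff-injective inj O inv (trans (sym (reverse-lookup o x)) (trans eq (reverse-lookup o y)))

      reverse-involutive : ∀ o → reverseOffOrbit (reverseOffOrbit (o , σ)) ≡ (o , σ)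
      reverse-involutive o = cong₂ _,_ (toggle-involutive o (cong not ∘ O′≗O ∘ suc))
        (lookup-ext λ x → trans (Vecₚ.lookup∘tabulate _ x) (reflectOff-involutive inj O inv (reverse-lookup o) O′≗O x))
        where
        O′≗O : ∀ a → onOrbit (proj₂ (reverseOffOrbit (o , σ))) a ≡ O a
        O′≗O = orbit?-reflectOff inj v₀ (reverse-lookup o)

      module _ {o : List Bool} (len : length o ≡ k ∸ 1) where

        private
          o′ = proj₁ (reverseOffOrbit (o , σ))
          toggled : ∀ {c} → 0 < c → c < k → lookupB o′ (c ∸ 1) ≡ lookupB o (c ∸ 1) xor not (O c)
          toggled {suc c} _ c<k = lookupB-toggle _ o (subst (c <_) (sym len) (ℕₚ.∸-monoˡ-≤ 1 c<k))

        same-on : ∀ {c} → O c ≡ true → SameAt k o o′ c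
        same-on Oc u v = trans (toggled u v) (trans (cong (λ b → lookupB o _ xor not b) Oc) (Boolₚ.xor-identityʳ _))

        opposite-off : ∀ {c} → O c ≡ false → OppositeAt k o o′ c
        opposite-off {c} Oc u v = trans (toggled u v) (trans (cong (λ b → lookupB o _ xor not b) Oc) (Boolₚ.xor-comm (lookupB o (c ∸ 1)) true))

        off≢0 : ∀ {a} → O a ≡ false → a ≢ 0
        off≢0 Oa refl with () ← trans (sym onOrbit-v₀) Oa

        -- After reindexing, a factor on the orbit keeps its arc and its bits, while off the orbit
        -- the arc from `j` to `f j` is compared with the arc from `f j` to `j` under flipped bits.
        -- Both ends are then off the orbit and so differ from v₁, where transposition would fail.
        weight-reverse : weight (reverseOffOrbit (o , σ)) ≡ weight (o , σ)
        weight-reverse = trans (∏-permute (λ i → entry o′ i (lookup (proj₂ (reverseOffOrbit (o , σ))) i)) (shiftOff inj O inv)) (∏-cong arc≡)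
          where
          π : Fin n → Fin n
          π = shiftOff inj O inv ⟨$⟩ʳ_
          arc≡ : ∀ j → entry o′ (π j) (lookup (proj₂ (reverseOffOrbit (o , σ))) (π j)) ≡ entry o j (f j)
          arc≡ j with O (toℕ j) in Oj
          ... | true = trans (cong (entry o′ j) (trans (reverse-lookup o j) (reflectOff-on inj O inv Oj)))
                             (sym (entry-same {o} {o′} j (f j) (same-on Oj) (same-on (trans (inv j) Oj))))
          ... | false = trans (cong (entry o′ (f j)) (trans (reverse-lookup o (f j)) (trans (reflectOff-off inj O inv Ofj) (inverseOf-left f inj j))))
                              (sym (entry-opposite {o} {o′} j (f j) (off≢0 Oj) (off≢0 Ofj) (opposite-off Oj) (opposite-off Ofj)))
            where Ofj = trans (inv j) Oj

        -- A vertex of K off the orbit would have its bit flipped, so the orientation alone would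
        -- already change; v₁ lies on its own orbit.
        reverse-fixed : reverseOffOrbit (o , σ) ≡ (o , σ) → ∀ {a} → a < k → O a ≡ true
        reverse-fixed eq {zero} _ = onOrbit-v₀
        reverse-fixed eq {suc a} a<k = Boolₚ.not-injective
          (toggle-fixed _ o (cong proj₁ eq) (subst (a <_) (sym len) (ℕₚ.∸-monoˡ-≤ 1 a<k)))

    configuration⁻ : ∀ {o σ} → (o , σ) ∈ configurations → length o ≡ k ∸ 1 × InjectiveVec σ
    configuration⁻ s∈ with o∈ , σ∈ ← ∈ₚ.∈-cartesianProduct⁻ (allBoolLists (k ∸ 1)) (perms n) s∈ =
      allBoolLists-length (k ∸ 1) o∈ , perms-injective σ∈

    configuration⁺ : ∀ {o σ} → length o ≡ k ∸ 1 → InjectiveVec σ → (o , σ) ∈ configurations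
    configuration⁺ {o} {σ} len inj = ∈ₚ.∈-cartesianProduct⁺ (subst (λ l → o ∈ allBoolLists l) len (allBoolLists-complete o)) (perms-complete σ inj)

    noFixedConfiguration⇒even : ∀ m → (∀ {s} → s ∈ withWeight m → reverseOffOrbit s ≢ s) → 2 ∣ length (withWeight m)
    noFixedConfiguration⇒even m noFixed =
      fixpointFreeInvolution⇒evenLength reverseOffOrbit (withWeight m) (Uniqueₚ.filter⁺ _ configurations-unique) pairs
      where
      pairs : PairsUp reverseOffOrbit (withWeight m)
      pairs {o , σ} s∈ with conf∈ , w≡ ← ∈ₚ.∈-filter⁻ (λ s → weight s ≟ᵀ just m) {xs = configurations} s∈
        with len , inj ← configuration⁻ conf∈ =
        ∈ₚ.∈-filter⁺ (λ s → weight s ≟ᵀ just m)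
          (configuration⁺ (trans (length-toggle _ o) len) (reverse-injective {σ} inj o)) (trans (weight-reverse {σ} inj {o} len) w≡)
        , reverse-involutive {σ} inj o
        , noFixed s∈

-- Degrees of a weight in single edge variables.

module Degrees {c ℓ} (R : CommutativeRing c ℓ) {n : ℕ} (G : SimpleGraph n) (k : ℕ) where
  open Poly R n
  open TermExpansion R n
  open Weights R G k

  exponent : Monomial → Fin n → Fin n → ℕ
  exponent μ p q = lookup (lookup μ p) q

  exponent-mon1 : ∀ p q → exponent mon1 p q ≡ 0
  exponent-mon1 p q = trans (cong (λ row → lookup row q) (Vecₚ.lookup-replicate p _)) (Vecₚ.lookup-replicate q 0)

  exponent-monVar : ∀ a b p q → exponent (monVar a b) p q ≡ 0 ⊎ (exponent (monVar a b) p q ≡ 1 × a ≡ p × b ≡ q)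
  exponent-monVar a b p q with p Finₚ.≟ a
  ... | no p≢a = inj₁ (trans (cong (λ row → lookup row q) (Vecₚ.lookup∘updateAt′ p a p≢a mon1)) (exponent-mon1 p q))
  ... | yes refl rewrite Vecₚ.lookup∘updateAt a {λ row → Vec.updateAt row b (λ _ → 1)} mon1 with q Finₚ.≟ b
  ...   | no q≢b = inj₁ (trans (Vecₚ.lookup∘updateAt′ q b q≢b (lookup mon1 a)) (exponent-mon1 a q))
  ...   | yes refl = inj₂ (Vecₚ.lookup∘updateAt b (lookup mon1 a) , refl , refl)

  exponent-monVar-self : ∀ a b → exponent (monVar a b) a b ≡ 1
  exponent-monVar-self a b rewrite Vecₚ.lookup∘updateAt a {λ row → Vec.updateAt row b (λ _ → 1)} mon1 =
    Vecₚ.lookup∘updateAt b (lookup mon1 a)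

  degree : Fin n → Fin n → Monomial → ℕ
  degree a b μ = if toℕ a <ᵇ toℕ b then exponent μ a b else exponent μ b a

  degree-mon1 : ∀ a b → degree a b mon1 ≡ 0
  degree-mon1 a b with toℕ a <ᵇ toℕ b
  ... | true = exponent-mon1 a b
  ... | false = exponent-mon1 b a

  degree-self : ∀ a b → degree a b (edgeMon a b) ≡ 1
  degree-self a b with toℕ a <ᵇ toℕ b
  ... | true = exponent-monVar-self a b
  ... | false = exponent-monVar-self b a

  degree-edgeMon : ∀ x y a b → degree a b (edgeMon x y) ≡ 0 ⊎
    (degree a b (edgeMon x y) ≡ 1 × ((x ≡ a × y ≡ b) ⊎ (x ≡ b × y ≡ a)))
  degree-edgeMon x y a b with toℕ a <ᵇ toℕ b | toℕ x <ᵇ toℕ y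
  ... | true  | true  = map₂ (λ (e , p , q) → e , inj₁ (p , q)) (exponent-monVar x y a b)
  ... | true  | false = map₂ (λ (e , p , q) → e , inj₂ (q , p)) (exponent-monVar y x a b)
  ... | false | true  = map₂ (λ (e , p , q) → e , inj₂ (p , q)) (exponent-monVar x y b a)
  ... | false | false = map₂ (λ (e , p , q) → e , inj₁ (q , p)) (exponent-monVar y x b a)

  module _ {o σ m} (w≡ : weight (o , σ) ≡ just m) where

    private
      factors = ∏-factors (λ i → entry o i (lookup σ i)) w≡

      μ : Fin n → Monomial
      μ = proj₁ factors

      view : ∀ i → EntryView o i (lookup σ i) (μ i)
      view i = entryView o i (lookup σ i) (proj₁ (proj₂ factors) i)

      degree-∑ : ∀ a b → degree a b m ≡ ∑ (degree a b ∘ μ)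
      degree-∑ a b with toℕ a <ᵇ toℕ b
      ... | true = proj₂ (proj₂ factors) a b
      ... | false = proj₂ (proj₂ factors) b a

      degree-entry : ∀ a b i → degree a b (μ i) ≡ 0 ⊎
        (degree a b (μ i) ≡ 1 × ((i ≡ a × lookup σ i ≡ b) ⊎ (i ≡ b × lookup σ i ≡ a)))
      degree-entry a b i with view i
      ... | loop _ _ eq = inj₁ (trans (cong (degree a b) eq) (degree-mon1 a b))
      ... | arc _ _ _ eq rewrite eq = degree-edgeMon i (lookup σ i) a b

      degree-positive : ∀ {a b} i → 1 ≤ degree a b (μ i) → (i ≡ a × lookup σ i ≡ b) ⊎ (i ≡ b × lookup σ i ≡ a)
      degree-positive {a} {b} i pos with degree-entry a b i
      ... | inj₂ (_ , ends) = ends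
      ... | inj₁ eq with () ← subst (1 ≤_) eq pos

      degree≤1 : ∀ a b i → degree a b (μ i) ≤ 1
      degree≤1 a b i with degree-entry a b i
      ... | inj₁ eq = subst (_≤ 1) (sym eq) z≤n
      ... | inj₂ (eq , _) = ℕₚ.≤-reflexive eq

      factor-degree : ∀ {a b} → a ≢ b → lookup σ a ≡ b → degree a b (μ a) ≡ 1
      factor-degree {a} {b} a≢b eq with view a
      ... | loop σa≡a _ _ = ⊥-elim (a≢b (trans σa≡a eq))
      ... | arc _ _ _ μ≡ rewrite μ≡ | eq = degree-self a b

      factor-degree′ : ∀ {a b} → a ≢ b → lookup σ b ≡ a → degree a b (μ b) ≡ 1
      factor-degree′ {a} {b} a≢b eq with view b
      ... | loop σb≡b _ _ = ⊥-elim (a≢b (sym (trans σb≡b eq)))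
      ... | arc _ _ _ μ≡ rewrite μ≡ | eq | edgeMon-sym {b} {a} (a≢b ∘ sym ∘ Finₚ.toℕ-injective) = degree-self a b

    arc⇒degree≥1 : ∀ {a b} → a ≢ b → lookup σ a ≡ b → 1 ≤ degree a b m
    arc⇒degree≥1 {a} {b} a≢b eq rewrite degree-∑ a b =
      ℕₚ.≤-trans (ℕₚ.≤-reflexive (sym (factor-degree a≢b eq))) (summand≤∑ (degree a b ∘ μ) a)

    twoArcs⇒degree≥2 : ∀ {a b} → a ≢ b → lookup σ a ≡ b → lookup σ b ≡ a → 2 ≤ degree a b m
    twoArcs⇒degree≥2 {a} {b} a≢b eq eq′ rewrite degree-∑ a b =
      ℕₚ.≤-trans (ℕₚ.≤-reflexive (sym (cong₂ _+_ (factor-degree a≢b eq) (factor-degree′ a≢b eq′)))) (two-summands≤∑ (degree a b ∘ μ) a≢b)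

    degree≥1⇒arc : ∀ {a b} → 1 ≤ degree a b m → lookup σ a ≡ b ⊎ lookup σ b ≡ a
    degree≥1⇒arc {a} {b} pos rewrite degree-∑ a b with i , p ← ∑-positive (degree a b ∘ μ) pos with degree-positive {a} {b} i p
    ... | inj₁ (refl , eq) = inj₁ eq
    ... | inj₂ (refl , eq) = inj₂ eq

    -- No factor has degree above 1 in one variable, so degree 2 comes from two different rows. Only
    -- the rows `a` and `b` can contribute, and they do so as opposite arcs.
    degree≥2⇒twoArcs : ∀ {a b} → 2 ≤ degree a b m → lookup σ a ≡ b × lookup σ b ≡ a
    degree≥2⇒twoArcs {a} {b} two rewrite degree-∑ a b
      with i , j , i≢j , p , q ← ∑≥2 (degree a b ∘ μ) (degree≤1 a b) two
      with degree-positive {a} {b} i p | degree-positive {a} {b} j q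
    ... | inj₁ (refl , eq) | inj₂ (refl , eq′) = eq , eq′
    ... | inj₂ (refl , eq) | inj₁ (refl , eq′) = eq′ , eq
    ... | inj₁ (i≡ , _) | inj₁ (j≡ , _) = ⊥-elim (i≢j (trans i≡ (sym j≡)))
    ... | inj₂ (i≡ , _) | inj₂ (j≡ , _) = ⊥-elim (i≢j (trans i≡ (sym j≡)))

  module _ {o o′ σ τ m} (w≡ : weight (o , σ) ≡ just m) (w≡′ : weight (o′ , τ) ≡ just m) where

    -- A weight records edges with multiplicity but without direction. Equal weights therefore
    -- transfer an arc only up to reversal, whereas an edge used both ways is transferred exactly.
    edge-transfer : ∀ {a b} → a ≢ b → lookup τ a ≡ b → lookup σ a ≡ b ⊎ lookup σ b ≡ a
    edge-transfer a≢b eq = degree≥1⇒arc {o} {σ} w≡ (arc⇒degree≥1 {o′} {τ} w≡′ a≢b eq)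

    twoCycle-transfer : ∀ {a b} → a ≢ b → lookup τ a ≡ b → lookup τ b ≡ a → lookup σ a ≡ b × lookup σ b ≡ a
    twoCycle-transfer a≢b eq eq′ = degree≥2⇒twoArcs {o} {σ} w≡ (twoArcs⇒degree≥2 {o′} {τ} w≡′ a≢b eq eq′)

-- Facts about traversals and about reading off orientation bits.

traversal-resp-≗ : ∀ {n} (G : SimpleGraph n) {cyc f g} → (∀ x → g x ≡ f x) → TraversesCycle G cyc f → TraversesCycle G cyc g
traversal-resp-≗ G {cyc} {f} {g} g≗f trav = record
  { injective = λ {x} {y} eq → T.injective (trans (sym (g≗f x)) (trans eq (g≗f y)))
  ; adjacent = λ {v} v∈ → subst (Adj G v) (sym (g≗f v)) (T.adjacent v∈)
  ; fixed = λ {v} v∉ → trans (g≗f v) (T.fixed v∉)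
  ; transitive = λ {u} u∈ v∈ → let i , eq = T.transitive u∈ v∈ in i , trans (fold-agree u (λ j → g≗f (fold u f j)) i) eq
  }
  where module T = TraversesCycle trav

-- Two nonadjacent vertices on the cycle rule out that it merely goes back and forth along one edge.
traversal-no2Cycle : ∀ {n} (G : SimpleGraph n) {cyc f} → TraversesCycle G cyc f →
  ∀ {a b} → a ∈ cyc → b ∈ cyc → a ≢ b → ¬ Adj G a b → ∀ {u} → u ∈ cyc → f (f u) ≢ u
traversal-no2Cycle G {cyc} {f} trav {a} {b} a∈ b∈ a≢b ¬adj {u} u∈ ffu≡u = clash (end a∈) (end b∈)
  where
  module T = TraversesCycle trav
  alternate : ∀ i → fold u f i ≡ u ⊎ fold u f i ≡ f u
  alternate zero = inj₁ refl
  alternate (suc i) with alternate i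
  ... | inj₁ eq = inj₂ (cong f eq)
  ... | inj₂ eq = inj₁ (trans (cong f eq) ffu≡u)
  end : ∀ {v} → v ∈ cyc → v ≡ u ⊎ v ≡ f u
  end v∈ with i , refl ← T.transitive u∈ v∈ = alternate i
  clash : a ≡ u ⊎ a ≡ f u → b ≡ u ⊎ b ≡ f u → ⊥
  clash (inj₁ refl) (inj₁ refl) = a≢b refl
  clash (inj₂ refl) (inj₂ refl) = a≢b refl
  clash (inj₁ refl) (inj₂ refl) = ¬adj (T.adjacent u∈)
  clash (inj₂ refl) (inj₁ refl) = ¬adj (trans (SimpleGraph.sym G _ _) (T.adjacent u∈))

traversal-∈ : ∀ {n} (G : SimpleGraph n) {cyc f} → TraversesCycle G cyc f → ∀ {v} → v ∈ cyc → f v ∈ cyc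
traversal-∈ {n} G {cyc} {f} trav {v} v∈ with f v ∈? cyc
... | yes fv∈ = fv∈
... | no fv∉ = ⊥-elim (Adj-irrefl G (T.adjacent v∈) (sym (T.injective (T.fixed fv∉))))
  where module T = TraversesCycle trav

lookupB-applyUpTo : ∀ (g : ℕ → Bool) {i m} → i < m → lookupB (applyUpTo g m) i ≡ g i
lookupB-applyUpTo g {zero} {suc m} _ = refl
lookupB-applyUpTo g {suc i} {suc m} (s≤s i<m) = lookupB-applyUpTo (g ∘ suc) i<m

lookupB-ext : ∀ o o′ → length o ≡ length o′ → (∀ {i} → i < length o → lookupB o i ≡ lookupB o′ i) → o ≡ o′
lookupB-ext [] [] _ _ = refl
lookupB-ext (b ∷ o) (b′ ∷ o′) len eq = cong₂ _∷_ (eq (s≤s z≤n)) (lookupB-ext o o′ (ℕₚ.suc-injective len) (eq ∘ s≤s))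

halve : ∀ d → ∃ λ a → d ≡ 2 * a ⊎ d ≡ 2 * a + 1
halve zero = 0 , inj₁ refl
halve (suc d) with halve d
... | a , inj₁ refl = a , inj₂ (ℕₚ.+-comm 1 (2 * a))
... | a , inj₂ refl = suc a , inj₁ (trans (cong suc (ℕₚ.+-comm (2 * a) 1)) (sym (ℕₚ.*-suc 2 a)))

two-of-three : ∀ {A : Set} {x y z a b : A} → x ≡ a ⊎ x ≡ b → y ≡ a ⊎ y ≡ b → z ≡ a ⊎ z ≡ b → y ≢ z → x ≡ y ⊎ x ≡ z
two-of-three (inj₁ refl) (inj₁ refl) _ _ = inj₁ refl
two-of-three (inj₁ refl) (inj₂ refl) (inj₁ refl) _ = inj₂ refl
two-of-three (inj₁ refl) (inj₂ refl) (inj₂ refl) y≢z = ⊥-elim (y≢z refl)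
two-of-three (inj₂ refl) (inj₂ refl) _ _ = inj₁ refl
two-of-three (inj₂ refl) (inj₁ refl) (inj₂ refl) _ = inj₂ refl
two-of-three (inj₂ refl) (inj₁ refl) (inj₁ refl) y≢z = ⊥-elim (y≢z refl)

module _ (k : ℕ) (o : List Bool) where

  wrongIn≢wrongOut : ∀ c → wrongIn k o c ≢ wrongOut k o c
  wrongIn≢wrongOut c eq with lookupB o (c ∸ 1)
  ... | true = ℕₚ.m+1+n≢m _ eq
  ... | false = ℕₚ.m+1+n≢m _ (sym eq)

  neighbour≢wrongOut : ∀ {b} c → b ≡ k + 2 * c ⊎ b ≡ k + 2 * c + 1 → b ≢ wrongOut k o c → b ≡ wrongIn k o c
  neighbour≢wrongOut c nb ≢out with lookupB o (c ∸ 1) | nb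
  ... | true  | inj₁ eq = ⊥-elim (≢out eq)
  ... | true  | inj₂ eq = eq
  ... | false | inj₁ eq = eq
  ... | false | inj₂ eq = ⊥-elim (≢out eq)

wrongIn-injective : ∀ k o o′ c → wrongIn k o c ≡ wrongIn k o′ c → lookupB o (c ∸ 1) ≡ lookupB o′ (c ∸ 1)
wrongIn-injective k o o′ c eq with lookupB o (c ∸ 1) | lookupB o′ (c ∸ 1)
... | true | true = refl
... | false | false = refl
... | true | false = ⊥-elim (ℕₚ.m+1+n≢m _ eq)
... | false | true = ⊥-elim (ℕₚ.m+1+n≢m _ (sym eq))

-- Passing between K-cycles and pairs of nonzero weight.

module KCycles {c ℓ} (R : CommutativeRing c ℓ) (n k : ℕ) (G : SimpleGraph n) (1<k : 1 < k) (3k≤n : 3 * k ≤ n)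
  (independent : ∀ (a b : Fin n) → toℕ a < k → toℕ b < k → ¬ Adj G a b)
  (neighbours : ∀ (a b : Fin n) → toℕ a < k → (Adj G a b ⇔ (toℕ b ≡ k + 2 * toℕ a ⊎ toℕ b ≡ k + 2 * toℕ a + 1))) where

  open Poly R n
  open MG R G k
  open TermExpansion R n
  open Weights R G k
  open Degrees R G k

  k≤n : k ≤ n
  k≤n = ℕₚ.≤-trans (ℕₚ.m≤m+n k _) 3k≤n

  kVertex : ∀ {a} → a < k → Fin n
  kVertex a<k = fromℕ< (ℕₚ.≤-trans a<k k≤n)

  toℕ-kVertex : ∀ {a} (a<k : a < k) → toℕ (kVertex a<k) ≡ a
  toℕ-kVertex a<k = Finₚ.toℕ-fromℕ< _

  0<k : 0 < k
  0<k = ℕₚ.<⇒≤ 1<k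

  v₀ v₁ : Fin n
  v₀ = kVertex 0<k
  v₁ = kVertex 1<k

  v₀≡0 : toℕ v₀ ≡ 0
  v₀≡0 = toℕ-kVertex 0<k

  v₀<k : toℕ v₀ < k
  v₀<k = subst (_< k) (sym v₀≡0) 0<k

  v₀≢v₁ : v₀ ≢ v₁
  v₀≢v₁ eq with () ← trans (sym v₀≡0) (trans (cong toℕ eq) (toℕ-kVertex 1<k))

  neighbour-v₀ : ∀ {b} → Adj G v₀ b → toℕ b ≡ k ⊎ toℕ b ≡ suc k
  neighbour-v₀ {b} adj with Equivalence.to (neighbours v₀ b v₀<k) adj
  ... | inj₁ eq = inj₁ (trans eq (trans (cong (λ a → k + 2 * a) v₀≡0) (ℕₚ.+-identityʳ k)))
  ... | inj₂ eq = inj₂ (trans eq (trans (cong (λ a → k + 2 * a + 1) v₀≡0) (trans (cong (_+ 1) (ℕₚ.+-identityʳ k)) (ℕₚ.+-comm k 1))))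

  a<k⇒¬3k≤a : ∀ {a} → a < k → ¬ 3 * k ≤ a
  a<k⇒¬3k≤a a<k 3k≤a = ℕₚ.<⇒≱ a<k (ℕₚ.≤-trans (ℕₚ.m≤m+n k _) 3k≤a)

  moved : ∀ {o a b μ} → toℕ a < k → EntryView o a b μ → Adj G a b × ¬ Forbidden k o (toℕ a) (toℕ b)
  moved a<k (loop _ 3k≤a _) = ⊥-elim (a<k⇒¬3k≤a a<k 3k≤a)
  moved a<k (arc _ adj ok _) = adj , ok

  -- v₁ cannot be fixed, since the diagonal vanishes below `3 * k`, and the entry towards its other
  -- neighbour is zeroed.
  step-v₀ : ∀ {o b μ} → EntryView o v₀ b μ → toℕ b ≡ k
  step-v₀ view with adj , ok ← moved v₀<k view with neighbour-v₀ adj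
  ... | inj₁ eq = eq
  ... | inj₂ eq = ⊥-elim (ok (inj₁ (v₀≡0 , eq)))

  -- The orbit of v₁ is longer than an edge: its first step goes to v_{k+1}, and the entry from
  -- there back to v₁ is zeroed.
  orbit⇒KCycle : ∀ {o σ m} → weight (o , σ) ≡ just m → InjectiveVec σ →
                 (∀ {a} → a < k → onOrbit v₀ v₀≡0 σ a ≡ true) → HasKCycle G k
  orbit⇒KCycle {o} {σ} w≡ inj K⊆O =
    let cyc , isCycle , orbit⊆ = orbit-isCycle G inj v₀ adj fx≢x ffx≢x
    in cyc , isCycle , λ v v<k → let i , eq = orbit?-sound f inj v₀ (K⊆O v<k) in subst (_∈ cyc) eq (orbit⊆ i)
    where
    f = lookup σ
    view = weight-view o σ w≡
    fx≢x : f v₀ ≢ v₀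
    fx≢x eq = Adj-irrefl G (proj₁ (moved v₀<k (proj₂ (view v₀)))) (sym eq)
    ffx≢x : f (f v₀) ≢ v₀
    ffx≢x eq with view (f v₀)
    ... | _ , loop fx≡ffx _ _ = fx≢x (trans fx≡ffx eq)
    ... | _ , arc _ _ ok _ = ok (inj₂ (inj₁ (step-v₀ (proj₂ (view v₀)) , trans (cong toℕ eq) v₀≡0)))
    adj : ∀ i → Adj G (fold v₀ f i) (fold v₀ f (suc i))
    adj i with view (fold v₀ f i)
    ... | _ , arc _ a _ _ = a
    -- A fixed point anywhere on the orbit would, by injectivity of the iterates, make `v₀` itself
    -- fixed.
    ... | _ , loop eq _ _ = ⊥-elim (fx≢x (sym (fold-injective inj i (trans eq (fold-suc f i)))))

  module _ {cyc f} (trav : TraversesCycle G cyc f) (K⊆cyc : ∀ v → toℕ v < k → v ∈ cyc) where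
    private module T = TraversesCycle trav

    no2Cycle : ∀ {u} → u ∈ cyc → f (f u) ≢ u
    no2Cycle = traversal-no2Cycle G trav (K⊆cyc v₀ v₀<k) (K⊆cyc v₁ v₁<k) v₀≢v₁ (independent v₀ v₁ v₀<k v₁<k)
      where v₁<k = subst (_< k) (sym (toℕ-kVertex 1<k)) 1<k

    -- A vertex of K has two neighbours, and its successor and predecessor on the cycle are two
    -- different ones by `no2Cycle`; so every neighbour is one of these.
    K-neighbour∈ : ∀ {a b} → toℕ a < k → Adj G a b → b ∈ cyc
    K-neighbour∈ {a} {b} a<k adj = [ (λ eq → subst (_∈ cyc) (sym (Finₚ.toℕ-injective eq)) (traversal-∈ G trav a∈))
                                   , (λ eq → subst (_∈ cyc) (sym (Finₚ.toℕ-injective eq)) (traversal-∈ G trav⁻ a∈)) ]′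
      (two-of-three (to b adj) (to (f a) (T.adjacent a∈)) (to (g a) (TraversesCycle.adjacent trav⁻ a∈))
        (λ eq → no2Cycle a∈ (trans (cong f (Finₚ.toℕ-injective eq)) (inverseOf-right f T.injective a))))
      where
      g = inverseOf f
      a∈ = K⊆cyc a a<k
      to = λ b → Equivalence.to (neighbours a b a<k)
      trav⁻ = reverse-traversal G (inverseOf-left f T.injective) (inverseOf-right f T.injective) trav

    -- Vertices off the cycle are to be fixed, which needs a diagonal entry 1. Below `3 * k` there
    -- are only vertices of K and their neighbours, and a K-cycle visits all of them.
    off-cycle⇒≥3k : ∀ {i} → i ∉ cyc → 3 * k ≤ toℕ i
    off-cycle⇒≥3k {i} i∉ with 3 * k ℕ.≤? toℕ i
    ... | yes 3k≤i = 3k≤i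
    ... | no 3k≰i = ⊥-elim (i∉ i∈)
      where
      k≤i : k ≤ toℕ i
      k≤i = ℕₚ.≮⇒≥ (i∉ ∘ K⊆cyc i)
      d = proj₁ (ℕₚ.m≤n⇒∃[o]m+o≡n k≤i)
      k+d≡i : k + d ≡ toℕ i
      k+d≡i = proj₂ (ℕₚ.m≤n⇒∃[o]m+o≡n k≤i)
      d<2k : d < 2 * k
      d<2k = ℕₚ.+-cancelˡ-< k d (2 * k) (subst (_< 3 * k) (sym k+d≡i) (ℕₚ.≰⇒> 3k≰i))
      attach : ∀ a → d ≡ 2 * a ⊎ d ≡ 2 * a + 1 → i ∈ cyc
      -- With `d` the offset of `i` above `k`, its half `a` is the index of the vertex of K to which
      -- `i` is attached.
      attach a d≡ = K-neighbour∈ a′<k (Equivalence.from (neighbours (kVertex a<k) i a′<k) (ends d≡))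
        where
        2a≤d : d ≡ 2 * a ⊎ d ≡ 2 * a + 1 → 2 * a ≤ d
        2a≤d (inj₁ eq) = ℕₚ.≤-reflexive (sym eq)
        2a≤d (inj₂ eq) = ℕₚ.≤-trans (ℕₚ.m≤m+n (2 * a) 1) (ℕₚ.≤-reflexive (sym eq))
        a<k : a < k
        a<k = ℕₚ.*-cancelˡ-< 2 a k (ℕₚ.≤-<-trans (2a≤d d≡) d<2k)
        a′<k = subst (_< k) (sym (toℕ-kVertex a<k)) a<k
        ends : d ≡ 2 * a ⊎ d ≡ 2 * a + 1 → toℕ i ≡ k + 2 * toℕ (kVertex a<k) ⊎ toℕ i ≡ k + 2 * toℕ (kVertex a<k) + 1
        ends rewrite toℕ-kVertex a<k = λ
          { (inj₁ eq) → inj₁ (trans (sym k+d≡i) (cong (k +_) eq))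
          ; (inj₂ eq) → inj₂ (trans (sym k+d≡i) (trans (cong (k +_) eq) (sym (ℕₚ.+-assoc k (2 * a) 1)))) }
      i∈ : i ∈ cyc
      i∈ = attach (proj₁ (halve d)) (proj₂ (halve d))

  module _ {cyc σ} (trav : TraversesCycle G cyc (lookup σ)) (K⊆cyc : ∀ v → toℕ v < k → v ∈ cyc)
           (fv₀≡k : toℕ (lookup σ v₀) ≡ k) where

    private
      module T = TraversesCycle trav
      f = lookup σ

      exits : ∀ a → Dec (∃ λ x → toℕ x ≡ a × toℕ (f x) ≡ k + 2 * a + 1)
      exits a = Finₚ.any? (λ x → (toℕ x ℕ.≟ a) ×-dec (toℕ (f x) ℕ.≟ k + 2 * a + 1))

    -- A bit is true where the traversal leaves for the second neighbour. This makes the successor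
    -- equal to `wrongIn`, the permitted exit.
    orientation : List Bool
    orientation = applyUpTo (λ i → does (exits (suc i))) (k ∸ 1)

    lookup-orientation : ∀ {a} → 0 < a → a < k → lookupB orientation (a ∸ 1) ≡ does (exits a)
    lookup-orientation {suc a} _ a<k = lookupB-applyUpTo _ (ℕₚ.∸-monoˡ-≤ 1 a<k)

    orientation-follows : ∀ c → 0 < toℕ c → toℕ c < k → toℕ (f c) ≡ wrongIn k orientation (toℕ c)
    orientation-follows c 0<c c<k rewrite lookup-orientation 0<c c<k with exits (toℕ c)
    ... | yes (x , x≡c , eq) = trans (cong (toℕ ∘ f) (sym (Finₚ.toℕ-injective x≡c))) eq
    ... | no ∄ with Equivalence.to (neighbours c (f c) c<k) (T.adjacent (K⊆cyc c c<k))
    ...   | inj₁ eq = eq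
    ...   | inj₂ eq = ⊥-elim (∄ (c , refl , eq))

    -- A forbidden arc out of v₁ or out of another vertex of K contradicts the chosen direction. A
    -- forbidden arc into a vertex of K would come from that vertex's own successor, so the
    -- traversal would run back along one edge.
    arcs-allowed : ∀ {i} → i ∈ cyc → ¬ Forbidden k orientation (toℕ i) (toℕ (f i))
    arcs-allowed {i} i∈ (inj₁ (i≡0 , fi≡1+k)) =
      ℕₚ.1+n≢n (trans (sym fi≡1+k) (trans (cong (toℕ ∘ f) (Finₚ.toℕ-injective (trans i≡0 (sym v₀≡0)))) fv₀≡k))
    arcs-allowed {i} i∈ (inj₂ (inj₁ (i≡k , fi≡0))) =
      no2Cycle trav K⊆cyc i∈ (trans (cong f (Finₚ.toℕ-injective (trans fi≡0 (sym v₀≡0)))) (Finₚ.toℕ-injective (trans fv₀≡k (sym i≡k))))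
    arcs-allowed {i} i∈ (inj₂ (inj₂ (inj₁ ((0<b , b<k) , i≡)))) =
      no2Cycle trav K⊆cyc i∈ (Finₚ.toℕ-injective (trans (orientation-follows (f i) 0<b b<k) (sym i≡)))
    arcs-allowed {i} i∈ (inj₂ (inj₂ (inj₂ ((0<a , a<k) , fi≡)))) =
      wrongIn≢wrongOut k orientation (toℕ i) (trans (sym (orientation-follows i 0<a a<k)) fi≡)

    loops-allowed : ∀ {a} → 3 * k ≤ a → ¬ Forbidden k orientation a a
    loops-allowed 3k≤a (inj₁ (refl , ()))
    loops-allowed 3k≤a (inj₂ (inj₁ (refl , refl))) with () ← 0<k
    loops-allowed 3k≤a (inj₂ (inj₂ (inj₁ ((_ , a<k) , _)))) = a<k⇒¬3k≤a a<k 3k≤a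
    loops-allowed 3k≤a (inj₂ (inj₂ (inj₂ ((_ , a<k) , _)))) = a<k⇒¬3k≤a a<k 3k≤a

    private
      entry-nonzero : ∀ i → ∃ λ μ → entry orientation i (f i) ≡ just μ
      entry-nonzero i with i ∈? cyc
      ... | yes i∈ = _ , entry-arc orientation i (f i) (Adj-irrefl G (T.adjacent i∈)) (T.adjacent i∈) (arcs-allowed i∈)
      ... | no i∉ rewrite T.fixed i∉ = _ , entry-loop orientation i 3k≤i (loops-allowed 3k≤i)
        where 3k≤i = off-cycle⇒≥3k trav K⊆cyc i∉

    traversal-weight : ∃ λ m → weight (orientation , σ) ≡ just m
    traversal-weight = ∏-total _ entry-nonzero

    module _ {m} (w≡ : weight (orientation , σ) ≡ just m) where

      module _ {o′ τ} (w≡′ : weight (o′ , τ) ≡ just m) (len′ : length o′ ≡ k ∸ 1) (inj′ : InjectiveVec τ) where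

        private
          view : ∀ i → ∃ (EntryView o′ i (lookup τ i))
          view = weight-view o′ τ w≡′
          g = lookup τ
          transfer : ∀ {a b} → a ≢ b → g a ≡ b → f a ≡ b ⊎ f b ≡ a
          transfer = edge-transfer {orientation} {o′} {σ} {τ} w≡ w≡′

        -- Suppose both maps step from `u` to `w`. The edge on which `g` leaves `w` lies on the
        -- cycle, so it leads on to `f w` or back to `u`. Going back would give the edge degree 2 in
        -- the common weight, and then `f` would use it twice as well.
        agree-along : ∀ i → g (fold v₀ f i) ≡ f (fold v₀ f i)
        agree-along zero = Finₚ.toℕ-injective (trans (step-v₀ (proj₂ (view v₀))) (sym fv₀≡k))
        agree-along (suc i) = [ sym , (λ eq → ⊥-elim (gw≢u (T.injective eq))) ]′ (transfer (gw≢w ∘ sym) refl)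
          where
          u = fold v₀ f i
          w = f u
          on-cycle : ∀ i → fold v₀ f i ∈ cyc
          on-cycle zero = K⊆cyc v₀ v₀<k
          on-cycle (suc i) = traversal-∈ G trav (on-cycle i)
          u≢w : u ≢ w
          u≢w = Adj-irrefl G (T.adjacent (on-cycle i))
          gw≢w : g w ≢ w
          gw≢w eq = u≢w (sym (inj′ (trans eq (sym (agree-along i)))))
          gw≢u : g w ≢ u
          gw≢u eq = no2Cycle trav K⊆cyc (on-cycle i)
            (proj₂ (twoCycle-transfer {orientation} {o′} {σ} {τ} w≡ w≡′ u≢w (agree-along i) eq))

        agree : ∀ x → g x ≡ f x
        agree x with x ∈? cyc
        ... | yes x∈ with i , refl ← T.transitive (K⊆cyc v₀ v₀<k) x∈ = agree-along i
        ... | no x∉ with g x Finₚ.≟ x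
        ...   | yes gx≡x = trans gx≡x (sym (T.fixed x∉))
        -- If `g` moved `x`, this edge would occur in the common weight, but `f` has no arc at the
        -- fixed vertex `x`.
        ...   | no gx≢x with transfer (gx≢x ∘ sym) refl
        ...     | inj₁ fx≡gx = sym fx≡gx
        ...     | inj₂ fgx≡x = ⊥-elim (gx≢x (T.injective (trans fgx≡x (sym (T.fixed x∉)))))

        -- Once the permutations agree, so do the orientations: under either one the exit from a
        -- vertex of K must be its `wrongIn`, and this determines the bit.
        same-configuration : (o′ , τ) ≡ (orientation , σ)
        same-configuration = cong₂ _,_
          (lookupB-ext o′ orientation (trans len′ (sym (Listₚ.length-applyUpTo _ (k ∸ 1)))) same-choice) (lookup-ext agree)
          where
          choice : ∀ {a} (a<k : a < k) → 0 < a → lookupB o′ (a ∸ 1) ≡ lookupB orientation (a ∸ 1)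
          choice {a} a<k 0<a = subst (λ a → lookupB o′ (a ∸ 1) ≡ lookupB orientation (a ∸ 1)) (toℕ-kVertex a<k)
            (wrongIn-injective k o′ orientation (toℕ v) (trans (sym (neighbour≢wrongOut k o′ (toℕ v)
              (Equivalence.to (neighbours v (g v) v<k) (proj₁ mv)) (λ eq → proj₂ mv (inj₂ (inj₂ (inj₂ ((0<v , v<k) , eq)))))))
              (trans (cong toℕ (agree v)) (orientation-follows v 0<v v<k))))
            where
            v = kVertex a<k
            0<v = subst (0 <_) (sym (toℕ-kVertex a<k)) 0<a
            v<k = subst (_< k) (sym (toℕ-kVertex a<k)) a<k
            mv = moved v<k (proj₂ (view v))
          same-choice : ∀ {i} → i < length o′ → lookupB o′ i ≡ lookupB orientation i
          same-choice {i} i< = choice (ℕₚ.≤-trans (s≤s (subst (i <_) len′ i<)) (ℕₚ.≤-reflexive (ℕₚ.m+[n∸m]≡n 0<k))) (s≤s z≤n)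

      withWeight-singleton : length (withWeight m) ≡ 1
      withWeight-singleton = unique-singleton {x = orientation , σ} (Uniqueₚ.filter⁺ _ configurations-unique)
        (∈ₚ.∈-filter⁺ (λ s → weight s ≟ᵀ just m)
          (configuration⁺ v₀ v₀≡0 (Listₚ.length-applyUpTo _ (k ∸ 1)) (λ {x} {y} → T.injective {x} {y})) w≡)
        λ {s} s∈ → let conf∈ , w≡′ = ∈ₚ.∈-filter⁻ (λ s → weight s ≟ᵀ just m) {xs = configurations} s∈
                       len′ , inj′ = configuration⁻ v₀ v₀≡0 conf∈
                   in same-configuration w≡′ len′ inj′

  -- If the cycle leaves v₁ through v_{k+2}, its inverse is taken. That one leaves through v_{k+1},
  -- since otherwise successor and predecessor of v₁ would coincide.
  KCycle⇒forward-traversal : HasKCycle G k → ∃ λ cyc → ∃ λ f → TraversesCycle G cyc f × (∀ v → toℕ v < k → v ∈ cyc) × toℕ (f v₀) ≡ k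
  KCycle⇒forward-traversal (cyc , isCycle , K⊆cyc) with f , trav ← cycle⇒traversal G cyc isCycle
    with neighbour-v₀ (TraversesCycle.adjacent trav (K⊆cyc v₀ v₀<k))
  ... | inj₁ eq = cyc , f , trav , K⊆cyc , eq
  ... | inj₂ eq = cyc , inverseOf f , trav⁻ , K⊆cyc , [ id , (λ eq′ → ⊥-elim (no2Cycle trav K⊆cyc v₀∈
        (trans (cong f (Finₚ.toℕ-injective (trans eq (sym eq′)))) (inverseOf-right f T.injective v₀)))) ]′
        (neighbour-v₀ (TraversesCycle.adjacent trav⁻ v₀∈))
    where
    module T = TraversesCycle trav
    v₀∈ = K⊆cyc v₀ v₀<k
    trav⁻ = reverse-traversal G (inverseOf-left f T.injective) (inverseOf-right f T.injective) trav

  KCycle⇒odd-weight : HasKCycle G k → ∃ λ m → length (withWeight m) ≡ 1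
  KCycle⇒odd-weight kcycle with cyc , f , trav , K⊆cyc , fv₀≡k ← KCycle⇒forward-traversal kcycle =
    m , withWeight-singleton {σ = σ} trav′ K⊆cyc fv₀≡k′ w≡
    where
    σ = tabulate f
    trav′ = traversal-resp-≗ G (Vecₚ.lookup∘tabulate f) trav
    fv₀≡k′ = trans (cong toℕ (Vecₚ.lookup∘tabulate f v₀)) fv₀≡k
    w = traversal-weight {σ = σ} trav′ K⊆cyc fv₀≡k′
    m = proj₁ w
    w≡ = proj₂ w

  FixedConfiguration : List Bool × Vec (Fin n) n → Set
  FixedConfiguration s = weight s ≢ nothing × reverseOffOrbit v₀ v₀≡0 s ≡ s

  -- Being nonzero is a negated statement from which no K-cycle can be extracted directly. The
  -- finite list of pairs is searched instead: a fixed pair of nonzero weight exhibits the cycle,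
  -- and its absence makes every count even.
  fixedConfiguration? : Dec (Any.Any FixedConfiguration configurations)
  fixedConfiguration? = Any.any? (λ s → ¬? (weight s ≟ᵀ nothing) ×-dec (reverseOffOrbit v₀ v₀≡0 s ≟ˢ s)) configurations
    where
    _≟ˢ_ : (s t : List Bool × Vec (Fin n) n) → Dec (s ≡ t)
    _≟ˢ_ = ×ₚ.≡-dec (Listₚ.≡-dec Bool._≟_) (Vecₚ.≡-dec Finₚ._≟_)

  noFixed⇒allEven : ¬ Any.Any FixedConfiguration configurations → ∀ m → 2 ∣ length (withWeight m)
  noFixed⇒allEven ∄ m = noFixedConfiguration⇒even v₀ v₀≡0 m λ {s} s∈ fixed →
    let conf∈ , w≡ = ∈ₚ.∈-filter⁻ (λ s → weight s ≟ᵀ just m) {xs = configurations} s∈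
    in ∄ (lose conf∈ ((λ w≡nothing → just≢nothing (trans (sym w≡) w≡nothing)) , fixed))
    where
    just≢nothing : ∀ {m : Monomial} → just m ≢ nothing
    just≢nothing ()

  fixedConfiguration⇒KCycle : ∀ {s} → s ∈ configurations → weight s ≢ nothing → reverseOffOrbit v₀ v₀≡0 s ≡ s → HasKCycle G k
  fixedConfiguration⇒KCycle {o , σ} conf∈ w≢nothing fixed =
    orbit⇒KCycle {o} {σ} (proj₂ (nonzeroTerm _ w≢nothing)) inj (reverse-fixed v₀ v₀≡0 {σ} inj {o} len fixed)
    where
    len = proj₁ (configuration⁻ v₀ v₀≡0 conf∈)
    inj : InjectiveVec σ
    inj = proj₂ (configuration⁻ v₀ v₀≡0 conf∈)
    nonzeroTerm : ∀ (e : Maybe Monomial) → e ≢ nothing → ∃ λ m → e ≡ just m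
    nonzeroTerm (just m) _ = m , refl
    nonzeroTerm nothing e≢ = ⊥-elim (e≢ refl)

  -- From parities of counts to the coefficients of `Q′`.

  module _ (char2 : CommutativeRing._≈_ R (CommutativeRing._+_ R (CommutativeRing.1# R) (CommutativeRing.1# R)) (CommutativeRing.0# R)) where
    open CommutativeRing R using (1#; 0#; _≈_; +-identityʳ) renaming (setoid to ≈-setoid)
    open import Algebra.Properties.Monoid.Mult (CommutativeRing.+-monoid R) using (×-congˡ) renaming (_×_ to _⊠_)

    coeff-Q′ : ∀ m → coeff m Q′ ≈ length (withWeight m) ⊠ 1#
    coeff-Q′ m = coeff-≋ m weight configurations
      (sumP-≋ (λ o → det (Mo o)) (λ o σ → weight (o , σ)) (λ o → det-≋ char2 (Mo o) (entry o) (Mo-≋ o)) (allBoolLists (k ∸ 1)))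

    single-weight⇒nonzero : ¬ 1# ≈ 0# → ∀ m → length (withWeight m) ≡ 1 → ¬ IsZeroPoly Q′
    single-weight⇒nonzero 1≉0 m single Q≈0 = 1≉0 (begin
      1#                          ≈⟨ +-identityʳ 1# ⟨
      1 ⊠ 1#                      ≈⟨ ×-congˡ single ⟨
      length (withWeight m) ⊠ 1#  ≈⟨ coeff-Q′ m ⟨
      coeff m Q′                  ≈⟨ Q≈0 m ⟩
      0#                          ∎)
      where open import Relation.Binary.Reasoning.Setoid ≈-setoid

    KCycle⇒nonzero : ¬ 1# ≈ 0# → HasKCycle G k → ¬ IsZeroPoly Q′
    KCycle⇒nonzero 1≉0 kcycle = single-weight⇒nonzero 1≉0 (proj₁ odd) (proj₂ odd)
      where odd = KCycle⇒odd-weight kcycle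

    allEven⇒zero : (∀ m → 2 ∣ length (withWeight m)) → IsZeroPoly Q′
    allEven⇒zero even m = CommutativeRing.trans R (coeff-Q′ m) (even⊠1≈0 char2 (even m))

    nonzero⇒KCycle : ¬ IsZeroPoly Q′ → HasKCycle G k
    nonzero⇒KCycle Q≢0 = case fixedConfiguration? of λ
      { (yes found) → let _ , conf∈ , w≢nothing , fixed = find found in fixedConfiguration⇒KCycle conf∈ w≢nothing fixed
      ; (no ∄) → ⊥-elim (Q≢0 (allEven⇒zero (noFixed⇒allEven ∄))) }

theorem8 : ∀ {c ℓ} (F : CommutativeRing c ℓ) → IsFieldChar2 F →
    (n k : ℕ) (G : SimpleGraph n) → 1 < k → 3 * k ≤ n →
    (∀ (a b : Fin n) → toℕ a < k → toℕ b < k → ¬ Adj G a b) →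
    (∀ (a b : Fin n) → toℕ a < k →
    (Adj G a b ⇔ (toℕ b ≡ k + 2 * toℕ a ⊎ toℕ b ≡ k + 2 * toℕ a + 1))) →
    (∀ (a b w : Fin n) → toℕ a < k → toℕ b < k → a ≢ b → Adj G a w → ¬ Adj G b w) →
    (HasKCycle G k ⇔ (¬ Poly.IsZeroPoly F n (MG.Q′ F G k)))
theorem8 F isF n k G 1<k 3k≤n independent neighbours _ =
  mk⇔ (KCycle⇒nonzero char2 nontrivial) (nonzero⇒KCycle char2)
  where
  open IsFieldChar2 isF using (char2; nontrivial)
  open KCycles F n k G 1<k 3k≤n independent neighbours
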